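{- If $q$ is a prime power and $d \in \mathbb{N}$, then $h_q(q^d - 1) = d-1 = \lfloor \log_q(q^d-1) \rfloor$.
   Context: For a prime power $q$ and $n \in \mathbb{N}$, let $\sigma:\mathbb{F}_q^n\to\mathbb{F}_q^n$ be the cyclic shift $\sigma(\sum_{i=1}^n x_i e_i)=\sum_{i=1}^n x_{i-1}e_i$ (indices mod $n$), where $e_1,\dots,e_n$ is the standard basis. A subspace $U\le \mathbb{F}_q^n$ is cyclically covering if $\bigcup_{r=0}^{n-1}\sigma^r(U)=\mathbb{F}_q^n$. $h_q(n)$ denotes the maximum possible codimension of a cyclically covering subspace of $\mathbb{F}_q^n$. -}

module Defs where

open import Level using (0ℓ)
open import Data.Nat using (ℕ; zero; suc; _∸_; _≤_)
open import Data.Nat.DivMod using (_mod_)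
open import Data.Fin using (Fin; toℕ)
import Data.Fin as F
open import Data.Product using (Σ; ∃; _×_; _,_)
import Data.Nat as N
open import Function using (_∘_)
open import Function.Bundles using (Inverse)
open import Relation.Nullary using (¬_)
import Relation.Binary.PropositionalEquality as ≡
open import Algebra.Bundles using (CommutativeRing)

record Field : Set₁ where
  field
    commRing : CommutativeRing 0ℓ 0ℓ
  open CommutativeRing commRing public
  field
    0≉1     : ¬ (0# ≈ 1#)
    inverse : ∀ x → ¬ (x ≈ 0#) → ∃ λ y → (x * y) ≈ 1#

HasSize : Field → ℕ → Set
HasSize F q = Inverse (Field.setoid F) (≡.setoid (Fin q))

module LinAlg (F : Field) where
  open Field F

  Vec : ℕ → Set
  Vec n = Fin n → Carrier

  _≈ᵥ_ : ∀ {n} → Vec n → Vec n → Set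
  u ≈ᵥ v = ∀ i → u i ≈ v i

  ∑ : ∀ {m} → (Fin m → Carrier) → Carrier
  ∑ {zero}  f = 0#
  ∑ {suc m} f = f F.zero + ∑ (f ∘ F.suc)

  lincomb : ∀ {m n} → (Fin m → Carrier) → (Fin m → Vec n) → Vec n
  lincomb c v j = ∑ (λ i → c i * v i j)

  LinIndep : ∀ {m n} → (Fin m → Vec n) → Set
  LinIndep v = ∀ c → lincomb c v ≈ᵥ (λ _ → 0#) → ∀ i → c i ≈ 0#

  record Subspace (n : ℕ) : Set where
    field
      dim   : ℕ
      basis : Fin dim → Vec n
      indep : LinIndep basis

  _∈_ : ∀ {n} → Vec n → Subspace n → Set
  x ∈ U = ∃ λ c → x ≈ᵥ lincomb c (Subspace.basis U)

  codim : ∀ {n} → Subspace n → ℕ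
  codim {n} U = n ∸ Subspace.dim U

  -- cyclic shift: σ(Σ x_i e_i) = Σ x_{i-1} e_i, i.e. (σ x)_i = x_{i-1 mod n}
  σ : ∀ {n} → Vec n → Vec n
  σ {suc k} x i = x ((toℕ i N.+ k) mod (suc k))

  σ^ : ∀ {n} → ℕ → Vec n → Vec n
  σ^ zero    x = x
  σ^ (suc r) x = σ (σ^ r x)

  CyclicallyCovering : ∀ {n} → Subspace n → Set
  CyclicallyCovering {n} U =
    ∀ (x : Vec n) → ∃ λ (r : Fin n) → ∃ λ (u : Vec n) →
      (u ∈ U) × (x ≈ᵥ σ^ (toℕ r) u)

  IsMaxCoveringCodim : ℕ → ℕ → Set
  IsMaxCoveringCodim n h =
    (Σ (Subspace n) λ U → CyclicallyCovering U × (codim U ≡.≡ h))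
    × (∀ (U : Subspace n) → CyclicallyCovering U → codim U ≤ h)

{-# OPTIONS --safe #-}

-- Upper bound: the N = q^d - 1 shifts of a covering subspace U cover F^N, so
-- q^N ≤ N |U| < q^d |U| and U has codimension less than d.
--
-- Lower bound: let w be a linear recurring sequence over F of order d and least
-- period N.  The map x ↦ Σ xₖ Xᵏ w, where X is the shift of sequences, sends F^N
-- onto the d-dimensional span of the shifts of w, and the N shifts of w are all
-- nonzero elements of that span.  Hence some rotation of x is mapped into the
-- line F w, whose preimage has codimension d - 1.
--
-- The sequence w replaces a primitive element of the field with q^d elements.
-- Put v = ∏ (1 - X^(N/p)) δ, over the primes p dividing N, where δ is the
-- indicator of N ℤ.  It is nonzero and killed by all (X^N - 1)/(X^(N/p) - 1), and
-- so is every w in F[X] v; as N ≠ 0 in F, such a w ≠ 0 has least period N.  Choose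
-- w satisfying a recurrence of least possible order D.  Then F[X]/Ann(w) is a
-- domain with q^D elements.  It contains the N distinct nonzero powers of X, so
-- d ≤ D, and all its elements are roots of Z^(q^d) - Z, so D ≤ d.
module Submission where

open import Defs
open import Level using (0ℓ)
open import Algebra.Bundles using (CommutativeRing)
open import Data.Nat using (ℕ; zero; suc; NonZero; s≤s; z≤n; _∸_; _≤_; _<_)
import Data.Nat as ℕ
import Data.Nat.Properties as ℕ
open import Data.Nat.Combinatorics using (_C_; nCn≡1; nC1≡n; nCk≡nC[n∸k])
open import Data.Nat.Divisibility using (_∣_; divides; _∣?_; ∣⇒≤; ∣1⇒≡1; n∣n; _∣0; ∣n⇒∣m*n; ∣m∣n⇒∣m+n; ∣m+n∣m⇒∣n; *-cancelʳ-∣)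
open import Data.Nat.DivMod using (_%_; _/_; _mod_; m≡m%n+[m/n]*n; m%n<n; %-distribˡ-+; m%n%n≡m%n; [m+kn]%n≡m%n; m<n⇒m%n≡m)
open import Data.Nat.GCD using (gcd; gcd-GCD; gcd[m,n]∣m; gcd[m,n]∣n; module Bézout)
open import Data.Nat.ListAction using (product)
open import Data.Nat.Primality using (Prime; prime?; prime⇒nonZero; euclidsLemma; ¬prime[1])
open import Data.Nat.Primality.Factorisation using (factorise)
open import Data.Nat.Tactic.RingSolver using (solve-∀)
open import Data.Fin using (Fin; zero; suc; toℕ; inject₁; fromℕ; fromℕ<; inject≤; punchIn; combine; funToFin; finToFun; splitAt; join; _↑ˡ_; _↑ʳ_)
import Data.Fin.Properties as Fin
open import Data.Fin.Permutation using (Permutation; permutation)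
open import Data.Fin.Relation.Unary.Top using (view; ‵fromℕ; ‵inject₁)
open import Data.List using ([]; _∷_)
open import Data.List.Relation.Unary.All using (_∷_)
open import Data.Vec.Functional using (replicate)
open import Data.Product using (∃; _×_; _,_; proj₁; proj₂)
open import Data.Sum using (_⊎_; inj₁; inj₂)
open import Data.Empty using (⊥-elim)
open import Function using (_∘_)
open import Function.Bundles using (Inverse)
open import Relation.Nullary using (¬_; Dec; yes; no; ¬?; _×-dec_)
open import Relation.Nullary.Decidable using (map′)
open import Relation.Binary using (tri<; tri≈; tri>)
open import Relation.Binary.PropositionalEquality as ≡ using (_≡_)

-- Roots of polynomials and the binomial theorem in commutative rings.

module RingTheory (R : CommutativeRing 0ℓ 0ℓ) where
  open CommutativeRing R hiding (zero)
  open import Relation.Binary.Reasoning.Setoid setoid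
  open import Algebra.Properties.Semiring.Sum semiring
  open import Algebra.Properties.Semiring.Mult semiring renaming (_×_ to _×′_)
  open import Algebra.Properties.CommutativeSemiring.Exp commutativeSemiring
  open import Algebra.Properties.CommutativeSemiring.Binomial commutativeSemiring
    using (binomialTerm) renaming (theorem to binomial-theorem)
  open import Algebra.Properties.Ring ring using (-1*x≈-x)
  open import Algebra.Properties.AbelianGroup +-abelianGroup using (x∙y⁻¹≈ε⇒x≈y; xyx⁻¹≈y)
  open import Algebra.Solver.Ring.NaturalCoefficients.Default commutativeSemiring

  sum-cong : ∀ n {f g : Fin n → Carrier} → (∀ i → f i ≈ g i) → sum f ≈ sum g
  sum-cong n = sum-cong-≋ {n}

  NoZeroDivisors : Set
  NoZeroDivisors = ∀ {x y} → x * y ≈ 0# → ¬ x ≈ 0# → y ≈ 0#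

  eval : ∀ {n} → (Fin n → Carrier) → Carrier → Carrier
  eval {zero}  c x = 0#
  eval {suc n} c x = c zero + x * eval (c ∘ suc) x

  eval-sum : ∀ {n} (c : Fin n → Carrier) x → eval c x ≈ ∑[ i < n ] (c i * x ^ toℕ i)
  eval-sum {zero}  c x = refl
  eval-sum {suc n} c x = begin
    c zero + x * eval (c ∘ suc) x                           ≈⟨ +-congˡ (*-congˡ (eval-sum (c ∘ suc) x)) ⟩
    c zero + x * ∑[ i < n ] (c (suc i) * x ^ toℕ i)         ≈⟨ +-cong (sym (*-identityʳ _)) (*-distribˡ-sum {n} x _) ⟩
    c zero * 1# + ∑[ i < n ] (x * (c (suc i) * x ^ toℕ i))  ≈⟨ +-congˡ (sum-cong n λ i → swap x (c (suc i)) (x ^ toℕ i)) ⟩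
    c zero * 1# + ∑[ i < n ] (c (suc i) * (x * x ^ toℕ i))  ∎
    where
    swap : ∀ a b c → a * (b * c) ≈ b * (a * c)
    swap = solve 3 (λ a b c → (a :* (b :* c)) := (b :* (a :* c))) refl

  -- Synthetic division by X - `a`: the j-th coefficient is the value at `a` of what remains of `c`
  -- after its j + 1 lowest coefficients are dropped.
  quotient : ∀ {n} → (Fin (suc n) → Carrier) → Carrier → Fin n → Carrier
  quotient c a zero    = eval (c ∘ suc) a
  quotient c a (suc j) = quotient (c ∘ suc) a j

  eval-cong : ∀ {n} (c : Fin n → Carrier) {x y} → x ≈ y → eval c x ≈ eval c y
  eval-cong {zero}  c x≈y = refl
  eval-cong {suc n} c x≈y = +-congˡ (*-cong x≈y (eval-cong (c ∘ suc) x≈y))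

  -- Division with remainder by X - `a`. The point is written `a + t` to avoid subtraction, so that
  -- the semiring solver applies.
  eval-quotient : ∀ {n} (c : Fin (suc n) → Carrier) a t →
    eval c (a + t) ≈ eval c a + t * eval (quotient c a) (a + t)
  eval-quotient {zero}  c a t = solve 3 (λ c a t →
    (c :+ (a :+ t) :* con 0) := (c :+ a :* con 0 :+ t :* con 0)) refl (c zero) a t
  eval-quotient {suc n} c a t = begin
    c zero + (a + t) * eval (c ∘ suc) (a + t)  ≈⟨ +-congˡ (*-congˡ (eval-quotient (c ∘ suc) a t)) ⟩
    c zero + (a + t) * (e + t * g)             ≈⟨ solve 5 (λ c a t e g →
      (c :+ (a :+ t) :* (e :+ t :* g)) := (c :+ a :* e :+ t :* (e :+ (a :+ t) :* g))) refl (c zero) a t e g ⟩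
    c zero + a * e + t * (e + (a + t) * g)     ∎
    where
    e = eval (c ∘ suc) a
    g = eval (quotient (c ∘ suc) a) (a + t)

  -- The remainder and the coefficients of the quotient are the values at `a` of the successive
  -- tails of `c`, and each coefficient of `c` is one such value minus `a` times the next.
  quotient≈0 : ∀ {n} (c : Fin (suc n) → Carrier) a → eval c a ≈ 0# →
    (∀ j → quotient c a j ≈ 0#) → ∀ i → c i ≈ 0#
  quotient≈0 {n} c a ca≈0 q≈0 zero = begin
    c zero                        ≈⟨ +-identityʳ _ ⟨
    c zero + 0#                   ≈⟨ +-congˡ (trans (*-congˡ (tail≈0 n c q≈0)) (zeroʳ a)) ⟨
    c zero + a * eval (c ∘ suc) a ≈⟨ ca≈0 ⟩
    0#                            ∎
    where
    tail≈0 : ∀ n (c : Fin (suc n) → Carrier) → (∀ j → quotient c a j ≈ 0#) → eval (c ∘ suc) a ≈ 0#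
    tail≈0 zero    c _ = refl
    tail≈0 (suc n) c h = h zero
  quotient≈0 {suc n} c a ca≈0 q≈0 (suc i) = quotient≈0 (c ∘ suc) a (q≈0 zero) (q≈0 ∘ suc) i

  -- Induction on the number of roots: divide by X - a for the first root a. Every other root
  -- differs from a and so, in the absence of zero divisors, is a root of the quotient.
  roots : NoZeroDivisors → ∀ {n} (c x : Fin n → Carrier) →
    (∀ {i j} → x i ≈ x j → i ≡ j) → (∀ i → eval c (x i) ≈ 0#) → ∀ i → c i ≈ 0#
  roots domain {suc n} c x x-inj cx≈0 =
    quotient≈0 c (x zero) (cx≈0 zero)
      (roots domain (quotient c a) (x ∘ suc) (λ eq → Fin.suc-injective (x-inj eq)) λ i →
        domain (begin
          (x (suc i) - a) * eval (quotient c a) (x (suc i))  ≈⟨ *-congˡ (eval-cong (quotient c a) (split (x (suc i)))) ⟩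
          (x (suc i) - a) * eval (quotient c a) (a + (x (suc i) - a))  ≈⟨ +-identityˡ _ ⟨
          0# + (x (suc i) - a) * eval (quotient c a) (a + (x (suc i) - a))  ≈⟨ +-congʳ (cx≈0 zero) ⟨
          eval c a + (x (suc i) - a) * eval (quotient c a) (a + (x (suc i) - a))  ≈⟨ eval-quotient c a _ ⟨
          eval c (a + (x (suc i) - a))  ≈⟨ eval-cong c (split (x (suc i))) ⟨
          eval c (x (suc i))            ≈⟨ cx≈0 (suc i) ⟩
          0#                            ∎)
          (λ eq → 0≢suc (x-inj (x∙y⁻¹≈ε⇒x≈y _ _ eq))))
    where
    a = x zero
    split : ∀ y → y ≈ a + (y - a)
    split y = trans (sym (xyx⁻¹≈y a y)) (+-assoc a y (- a))
    0≢suc : ∀ {i : Fin n} → ¬ suc i ≡ zero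
    0≢suc ()

  monomial : ∀ n → Fin (suc n) → Carrier
  monomial zero    _       = 1#
  monomial (suc n) zero    = 0#
  monomial (suc n) (suc i) = monomial n i

  eval-monomial : ∀ n x → eval (monomial n) x ≈ x ^ n
  eval-monomial zero    x = trans (+-congˡ (zeroʳ x)) (+-identityʳ 1#)
  eval-monomial (suc n) x = trans (+-identityˡ _) (*-congˡ (eval-monomial n x))

  monomial-leading : ∀ n → monomial n (fromℕ n) ≈ 1#
  monomial-leading zero    = refl
  monomial-leading (suc n) = monomial-leading n

  -- The points would be n + 3 roots of Z^(n+2) - Z. An exponent of at least 2 keeps the two terms
  -- apart, so the leading coefficient is 1.
  few-fixed-points : NoZeroDivisors → ¬ 1# ≈ 0# → ∀ n (x : Fin (3 ℕ.+ n) → Carrier) →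
    (∀ {i j} → x i ≈ x j → i ≡ j) → ¬ (∀ i → x i ^ (2 ℕ.+ n) ≈ x i)
  few-fixed-points domain 1≉0 n x x-inj fixed = 1≉0 (begin
    1#                     ≈⟨ monomial-leading n ⟨
    c (suc (suc (fromℕ n))) ≈⟨ roots domain c x x-inj vanish (suc (suc (fromℕ n))) ⟩
    0#                     ∎)
    where
    c : Fin (3 ℕ.+ n) → Carrier
    c zero          = 0#
    c (suc zero)    = - 1#
    c (suc (suc i)) = monomial n i
    vanish : ∀ i → eval c (x i) ≈ 0#
    vanish i = begin
      0# + y * (- 1# + y * eval (monomial n) y) ≈⟨ +-identityˡ _ ⟩
      y * (- 1# + y * eval (monomial n) y)      ≈⟨ distribˡ y _ _ ⟩
      y * - 1# + y * (y * eval (monomial n) y)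
        ≈⟨ +-cong (trans (*-comm y _) (-1*x≈-x y)) (trans (*-congˡ (*-congˡ (eval-monomial n y))) (fixed i)) ⟩
      - y + y                                   ≈⟨ -‿inverseˡ y ⟩
      0#                                        ∎
      where y = x i

  middleTerm : ∀ m → Carrier → Carrier → Fin m → Carrier
  middleTerm m x y j = (suc m C suc (toℕ j)) ×′ (x ^ suc (toℕ j) * y ^ (m ∸ toℕ j))

  -- Isolates the two pure powers; the binomial coefficients left in the sum are the ones that
  -- vanish over a field with `suc m` elements.
  binomial-ends : ∀ m x y →
    (x + y) ^ suc m ≈ x ^ suc m + y ^ suc m + ∑[ j < m ] middleTerm m x y j
  binomial-ends m x y = begin
    (x + y) ^ suc m       ≈⟨ binomial-theorem (suc m) x y ⟩
    t zero + sum (t ∘ suc)  ≈⟨ +-cong first (trans (sum-init-last (t ∘ suc)) (+-cong middle last≈)) ⟩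
    y ^ suc m + (∑[ j < m ] middleTerm m x y j + x ^ suc m)  ≈⟨ lemma (x ^ suc m) (y ^ suc m) _ ⟩
    x ^ suc m + y ^ suc m + ∑[ j < m ] middleTerm m x y j  ∎
    where
    t = binomialTerm x y (suc m)
    lemma : ∀ a b s → b + (s + a) ≈ a + b + s
    lemma a b s = solve 3 (λ a b s → (b :+ (s :+ a)) := (a :+ b :+ s)) refl a b s
    first : t zero ≈ y ^ suc m
    first = trans (×-congˡ (≡.trans (nCk≡nC[n∸k] {0} {suc m} z≤n) (nCn≡1 (suc m))))
              (trans (×-homo-1 _) (*-identityˡ _))
    middle : ∑[ j < m ] t (suc (inject₁ j)) ≈ ∑[ j < m ] middleTerm m x y j
    middle = sum-cong m λ j → reflexive (≡.cong
      (λ k → (suc m C suc k) ×′ (x ^ suc k * y ^ (m ∸ k))) (Fin.toℕ-inject₁ j))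
    last≈ : t (suc (fromℕ m)) ≈ x ^ suc m
    last≈ = trans (reflexive (≡.cong (λ k → (suc m C suc k) ×′ (x ^ suc k * y ^ (m ∸ k))) (Fin.toℕ-fromℕ m)))
              (trans (×-cong (nCn≡1 (suc m)) (*-congˡ (^-congʳ y (ℕ.n∸n≡0 m))))
                (trans (×-homo-1 _) (*-identityʳ _)))

  ×≈×1* : ∀ n x → n ×′ x ≈ (n ×′ 1#) * x
  ×≈×1* n x = sym (trans (×-assoc-* n 1# x) (×-congʳ n (*-identityˡ x)))

  -- The exponent will be the size of the field rather than its characteristic. The vanishing of the
  -- binomials is a hypothesis so that the lemma also applies to the ring `K`, which inherits it
  -- from the field.
  frobenius : ∀ m → (∀ (j : Fin m) → (suc m C suc (toℕ j)) ×′ 1# ≈ 0#) →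
    ∀ x y → (x + y) ^ suc m ≈ x ^ suc m + y ^ suc m
  frobenius m bin≈0 x y = begin
    (x + y) ^ suc m  ≈⟨ binomial-ends m x y ⟩
    x ^ suc m + y ^ suc m + ∑[ j < m ] middleTerm m x y j
      ≈⟨ +-congˡ (sum-cong m λ j → trans (×≈×1* (suc m C suc (toℕ j)) _) (trans (*-congʳ (bin≈0 j)) (zeroˡ _))) ⟩
    x ^ suc m + y ^ suc m + ∑[ j < m ] 0#  ≈⟨ +-congˡ (sum-replicate-zero m) ⟩
    x ^ suc m + y ^ suc m + 0#  ≈⟨ +-identityʳ _ ⟩
    x ^ suc m + y ^ suc m       ∎

  frobenius-iterate : ∀ m → (∀ (j : Fin m) → (suc m C suc (toℕ j)) ×′ 1# ≈ 0#) →
    ∀ d x y → (x + y) ^ (suc m ℕ.^ d) ≈ x ^ (suc m ℕ.^ d) + y ^ (suc m ℕ.^ d)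
  frobenius-iterate m bin≈0 zero    x y = trans (*-identityʳ _) (+-cong (sym (*-identityʳ _)) (sym (*-identityʳ _)))
  frobenius-iterate m bin≈0 (suc d) x y = begin
    (x + y) ^ (suc m ℕ.* Q)          ≈⟨ ^-assocʳ (x + y) (suc m) Q ⟨
    ((x + y) ^ suc m) ^ Q                   ≈⟨ ^-congˡ Q (frobenius m bin≈0 x y) ⟩
    (x ^ suc m + y ^ suc m) ^ Q             ≈⟨ frobenius-iterate m bin≈0 d _ _ ⟩
    (x ^ suc m) ^ Q + (y ^ suc m) ^ Q       ≈⟨ +-cong (^-assocʳ x (suc m) Q) (^-assocʳ y (suc m) Q) ⟩
    x ^ (suc m ℕ.* Q) + y ^ (suc m ℕ.* Q) ∎
    where Q = suc m ℕ.^ d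

  -- The coefficients 0, C(n,1), …, C(n,n-1) of (x+1)ⁿ - xⁿ - 1 vanish
  -- because this polynomial has degree < n and n roots.
  binomials≈0 : NoZeroDivisors → ∀ m (x : Fin (suc m) → Carrier) →
    (∀ {i j} → x i ≈ x j → i ≡ j) → (∀ a → a ^ suc m ≈ a) →
    ∀ (j : Fin m) → (suc m C suc (toℕ j)) ×′ 1# ≈ 0#
  binomials≈0 domain m x x-inj fermat j = roots domain c x x-inj (λ i → vanish (x i)) (suc j)
    where
    c : Fin (suc m) → Carrier
    c zero    = 0#
    c (suc j) = (suc m C suc (toℕ j)) ×′ 1#
    1^n≈1 : ∀ n → 1# ^ n ≈ 1#
    1^n≈1 zero    = refl
    1^n≈1 (suc n) = trans (*-identityˡ _) (1^n≈1 n)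
    vanish : ∀ a → eval c a ≈ 0#
    vanish a = begin
      eval c a   ≈⟨ eval-sum c a ⟩
      0# * 1# + ∑[ j < m ] (c (suc j) * a ^ suc (toℕ j))
        ≈⟨ trans (+-congʳ (zeroˡ _)) (+-identityˡ _) ⟩
      ∑[ j < m ] (c (suc j) * a ^ suc (toℕ j))
        ≈⟨ sum-cong m (λ j → trans (sym (×≈×1* (suc m C suc (toℕ j)) _)) (×-congʳ (suc m C suc (toℕ j)) (trans (sym (*-identityʳ _)) (*-congˡ (sym (1^n≈1 (m ∸ toℕ j))))))) ⟩
      s                        ≈⟨ xyx⁻¹≈y (a + 1#) s ⟨
      (a + 1#) + s - (a + 1#)  ≈⟨ +-congʳ (+-congʳ (+-cong (fermat a) (fermat 1#))) ⟨
      (a ^ suc m + 1# ^ suc m) + s - (a + 1#) ≈⟨ +-congʳ (binomial-ends m a 1#) ⟨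
      (a + 1#) ^ suc m - (a + 1#)  ≈⟨ +-congʳ (fermat (a + 1#)) ⟩
      (a + 1#) - (a + 1#)          ≈⟨ -‿inverseʳ _ ⟩
      0#  ∎
      where s = ∑[ j < m ] middleTerm m a 1# j

-- Finite fields: enumeration of vectors, Fermat's theorem, vanishing binomials.

module FiniteField (F : Field) (m : ℕ) (size : HasSize F (suc (suc m))) where
  open Field F hiding (zero)
  open RingTheory commRing public
  open Inverse size using (to; from; to-cong; strictlyInverseˡ; strictlyInverseʳ)
  open import Algebra.Properties.Semiring.Mult semiring renaming (_×_ to _×′_)
  open import Algebra.Properties.CommutativeSemiring.Exp commutativeSemiring
  open import Relation.Binary.Reasoning.Setoid setoid

  q : ℕ
  q = suc (suc m)

  to-injective : ∀ {x y} → to x ≡ to y → x ≈ y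
  to-injective {x} {y} eq = begin
    x           ≈⟨ strictlyInverseʳ x ⟨
    from (to x) ≡⟨ ≡.cong from eq ⟩
    from (to y) ≈⟨ strictlyInverseʳ y ⟩
    y           ∎

  from-injective : ∀ {i j} → from i ≈ from j → i ≡ j
  from-injective {i} {j} eq =
    ≡.trans (≡.sym (strictlyInverseˡ i)) (≡.trans (to-cong eq) (strictlyInverseˡ j))

  infix 4 _≟_
  _≟_ : ∀ x y → Dec (x ≈ y)
  x ≟ y = map′ to-injective to-cong (to x Fin.≟ to y)

  noZeroDivisors : NoZeroDivisors
  noZeroDivisors {x} {y} xy≈0 x≉0 with inverse x x≉0
  ... | x⁻¹ , xx⁻¹≈1 = begin
    y               ≈⟨ *-identityˡ y ⟨
    1# * y          ≈⟨ *-congʳ (trans (*-comm x⁻¹ x) xx⁻¹≈1) ⟨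
    x⁻¹ * x * y     ≈⟨ *-assoc _ _ _ ⟩
    x⁻¹ * (x * y)   ≈⟨ *-congˡ xy≈0 ⟩
    x⁻¹ * 0#        ≈⟨ zeroʳ _ ⟩
    0#              ∎

  code : ∀ {n} → (Fin n → Carrier) → Fin (q ℕ.^ n)
  code u = funToFin (to ∘ u)

  decode : ∀ {n} → Fin (q ℕ.^ n) → Fin n → Carrier
  decode k = from ∘ finToFun k

  code-injective : ∀ {n} {u v : Fin n → Carrier} → code u ≡ code v → ∀ i → u i ≈ v i
  code-injective {_} {u} {v} eq i = to-injective
    (≡.trans (≡.sym (Fin.finToFun-funToFin (to ∘ u) i))
      (≡.trans (≡.cong (λ k → finToFun k i) eq) (Fin.finToFun-funToFin (to ∘ v) i)))

  decode-code : ∀ {n} (u : Fin n → Carrier) i → decode (code u) i ≈ u i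
  decode-code u i = trans (reflexive (≡.cong from (Fin.finToFun-funToFin (to ∘ u) i))) (strictlyInverseʳ (u i))

  funToFin-cong : ∀ {k n} {f g : Fin k → Fin n} → (∀ i → f i ≡ g i) → funToFin f ≡ funToFin g
  funToFin-cong {zero}  f≗g = ≡.refl
  funToFin-cong {suc k} f≗g = ≡.cong₂ combine (f≗g zero) (funToFin-cong (f≗g ∘ suc))

  decode-injective : ∀ {n} {k l : Fin (q ℕ.^ n)} → (∀ i → decode {n} k i ≈ decode l i) → k ≡ l
  decode-injective {n} {k} {l} eq = ≡.trans (≡.sym (Fin.funToFin-finToFin {n} {q} k))
    (≡.trans (funToFin-cong (from-injective ∘ eq)) (Fin.funToFin-finToFin {n} {q} l))

  -- Exhaustive search through the codes. A vector is recovered from its code only up to pointwise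
  -- equality, so `P` has to respect that.
  search : ∀ {n} (P : (Fin n → Carrier) → Set) →
    (∀ {u v} → (∀ i → u i ≈ v i) → P u → P v) → (∀ u → Dec (P u)) → Dec (∃ P)
  search {n} P resp P? = map′ (λ (k , p) → decode k , p)
    (λ (u , p) → code u , resp (λ i → sym (decode-code u i)) p)
    (Fin.any? (P? ∘ decode {n}))

  private
    module ∏ where
      open import Algebra.Properties.CommutativeMonoid.Sum *-commutativeMonoid public

    ifZero : (x u v : Carrier) → Carrier
    ifZero x u v with x ≟ 0#
    ... | yes _ = u
    ... | no  _ = v

    ifZero-yes : ∀ {x u v} → x ≈ 0# → ifZero x u v ≈ u
    ifZero-yes {x} x≈0 with x ≟ 0#
    ... | yes _   = refl
    ... | no  x≉0 = ⊥-elim (x≉0 x≈0)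

    ifZero-no : ∀ {x u v} → ¬ x ≈ 0# → ifZero x u v ≈ v
    ifZero-no {x} x≉0 with x ≟ 0#
    ... | yes x≈0 = ⊥-elim (x≉0 x≈0)
    ... | no  _   = refl

    ∏-nonzero : ∀ n (f : Fin n → Carrier) → (∀ i → ¬ f i ≈ 0#) → ¬ ∏.sum f ≈ 0#
    ∏-nonzero zero    f f≉0 eq = 0≉1 (sym eq)
    ∏-nonzero (suc n) f f≉0 eq = ∏-nonzero n (f ∘ suc) (f≉0 ∘ suc) (noZeroDivisors eq (f≉0 zero))

  -- Multiplication by a permutes the nonzero elements, so their product P
  -- satisfies a^(q-1) P = P; the factor belonging to 0 supplies the missing a.
  fermat : ∀ a → a ^ q ≈ a
  fermat a with a ≟ 0#
  ... | yes a≈0 = trans (*-congʳ {a ^ suc m} a≈0) (trans (zeroˡ (a ^ suc m)) (sym a≈0))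
  ... | no a≉0 = begin
    a ^ q                                         ≈⟨ ∏.sum-replicate q {a} ⟨
    ∏.sum (replicate q a)                         ≈⟨ ∏.sum-cong-≋ {q} {replicate q a} split ⟩
    ∏.sum (λ i → scale i * unscaled i)  ≈⟨ ∏.∑-distrib-+ scale unscaled ⟩
    K * ∏.sum unscaled        ≈⟨ *-cong K≈1 only-a ⟩
    1# * a                                        ≈⟨ *-identityˡ a ⟩
    a                                             ∎
    where
    a⁻¹ = proj₁ (inverse a a≉0)
    aa⁻¹≈1 = proj₂ (inverse a a≉0)

    scale-unscale : ∀ b c → b * c ≈ 1# → ∀ i → to (b * from (to (c * from i))) ≡ i
    scale-unscale b c bc≈1 i = ≡.trans (to-cong (begin
      b * from (to (c * from i)) ≈⟨ *-congˡ (strictlyInverseʳ _) ⟩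
      b * (c * from i)           ≈⟨ *-assoc b c _ ⟨
      b * c * from i             ≈⟨ *-congʳ bc≈1 ⟩
      1# * from i                ≈⟨ *-identityˡ _ ⟩
      from i                     ∎)) (strictlyInverseˡ i)

    π : Permutation q q
    π = permutation (λ i → to (a * from i)) (λ i → to (a⁻¹ * from i))
      (scale-unscale a a⁻¹ aa⁻¹≈1) (scale-unscale a⁻¹ a (trans (*-comm _ _) aa⁻¹≈1))

    scale unscaled nonzero : Fin q → Carrier
    scale    i = ifZero (from i) 1# a
    unscaled i = ifZero (from i) a 1#
    nonzero  i = ifZero (from i) 1# (from i)

    K P : Carrier
    K = ∏.sum scale
    P = ∏.sum nonzero

    split : ∀ i → a ≈ scale i * unscaled i
    split i with from i ≟ 0#
    ... | yes _ = sym (*-identityˡ a)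
    ... | no  _ = sym (*-identityʳ a)

    scaled : ∀ i → nonzero (to (a * from i))
                 ≈ scale i * nonzero i
    scaled i with from i ≟ 0#
    ... | yes x≈0 = trans (ifZero-yes (trans (strictlyInverseʳ _) (trans (*-congˡ x≈0) (zeroʳ a)))) (sym (*-identityʳ 1#))
    ... | no  x≉0 = trans (ifZero-no (λ eq → x≉0 (noZeroDivisors (trans (sym (strictlyInverseʳ _)) eq) a≉0))) (strictlyInverseʳ _)

    KP≈P : K * P ≈ P
    KP≈P = begin
      K * P  ≈⟨ ∏.∑-distrib-+ scale nonzero ⟨
      ∏.sum (λ i → scale i * nonzero i)  ≈⟨ ∏.sum-cong-≋ {q} {λ i → nonzero (to (a * from i))} scaled ⟨
      ∏.sum (λ i → nonzero (to (a * from i)))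
        ≈⟨ ∏.sum-permute nonzero π ⟨
      P      ∎

    P≉0 : ¬ P ≈ 0#
    P≉0 = ∏-nonzero q _ factor≉0
      where
      factor≉0 : ∀ i → ¬ nonzero i ≈ 0#
      factor≉0 i with from i ≟ 0#
      ... | yes _   = λ eq → 0≉1 (sym eq)
      ... | no  x≉0 = x≉0

    K≈1 : K ≈ 1#
    K≈1 = begin
      K                          ≈⟨ *-identityʳ K ⟨
      K * 1#                     ≈⟨ *-congˡ PP⁻¹≈1 ⟨
      K * (P * P⁻¹)              ≈⟨ *-assoc _ _ _ ⟨
      K * P * P⁻¹                ≈⟨ *-congʳ KP≈P ⟩
      P * P⁻¹                    ≈⟨ PP⁻¹≈1 ⟩
      1#                         ∎
      where
      P⁻¹ = proj₁ (inverse P P≉0)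
      PP⁻¹≈1 = proj₂ (inverse P P≉0)

    i₀ = to 0#

    only-a : ∏.sum unscaled ≈ a
    only-a = begin
      ∏.sum unscaled  ≈⟨ ∏.sum-remove {i = i₀} unscaled ⟩
      unscaled i₀ * ∏.sum (λ j → unscaled (punchIn i₀ j))
        ≈⟨ *-cong (ifZero-yes (strictlyInverseʳ 0#)) (∏.sum-cong-≋ {suc m} {λ j → unscaled (punchIn i₀ j)} {replicate (suc m) 1#} λ j →
             ifZero-no λ eq → Fin.punchInᵢ≢i i₀ j (≡.trans (≡.sym (strictlyInverseˡ _)) (to-cong eq))) ⟩
      a * ∏.sum (replicate (suc m) 1#)   ≈⟨ *-congˡ (∏.sum-replicate-zero (suc m)) ⟩
      a * 1#                             ≈⟨ *-identityʳ a ⟩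
      a                                  ∎

  binomial≈0 : ∀ (j : Fin (suc m)) → (q C suc (toℕ j)) ×′ 1# ≈ 0#
  binomial≈0 = binomials≈0 noZeroDivisors (suc m) from from-injective fermat

  -- The first of the vanishing binomials is C(q,1) = q.
  size×1≈0 : q ×′ 1# ≈ 0#
  size×1≈0 = trans (reflexive (≡.cong (_×′ 1#) (≡.sym (nC1≡n q)))) (binomial≈0 zero)

-- Sequences as a module over the polynomials in the shift operator.

module Sequences (R : CommutativeRing 0ℓ 0ℓ) where
  open CommutativeRing R hiding (zero)
  open RingTheory R using (sum-cong)
  open import Algebra.Properties.Semiring.Sum semiring
  open import Algebra.Properties.Ring ring using (-1*x≈-x)
  open import Algebra.Properties.Group +-group using (x∙y⁻¹≈ε⇒x≈y)
  open import Algebra.Solver.Ring.NaturalCoefficients.Default commutativeSemiring using (solve; _:=_; _:+_; _:*_)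
  open import Relation.Binary.Reasoning.Setoid setoid

  Seq : Set
  Seq = ℕ → Carrier

  infix 4 _≐_
  _≐_ : Seq → Seq → Set
  s ≐ t = ∀ i → s i ≈ t i

  -- Polynomials in the shift operator X, as unevaluated expressions: products
  -- act by composition, so that no multiplication of coefficients is needed.
  infixl 6 _⊕_
  infixl 7 _⊗_
  data Poly : Set where
    con     : Carrier → Poly
    X       : Poly
    _⊕_ _⊗_ : Poly → Poly → Poly

  ⟦_⟧ : Poly → Seq → Seq
  ⟦ con a ⟧ s i = a * s i
  ⟦ X     ⟧ s i = s (suc i)
  ⟦ p ⊕ r ⟧ s i = ⟦ p ⟧ s i + ⟦ r ⟧ s i
  ⟦ p ⊗ r ⟧ s i = ⟦ p ⟧ (⟦ r ⟧ s) i

  ⟦⟧-cong : ∀ p {s t} → s ≐ t → ⟦ p ⟧ s ≐ ⟦ p ⟧ t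
  ⟦⟧-cong (con a) s≐t i = *-congˡ (s≐t i)
  ⟦⟧-cong X       s≐t i = s≐t (suc i)
  ⟦⟧-cong (p ⊕ r) s≐t i = +-cong (⟦⟧-cong p s≐t i) (⟦⟧-cong r s≐t i)
  ⟦⟧-cong (p ⊗ r) s≐t i = ⟦⟧-cong p (⟦⟧-cong r s≐t) i

  ⟦⟧-+ : ∀ p s t → ⟦ p ⟧ (λ i → s i + t i) ≐ λ i → ⟦ p ⟧ s i + ⟦ p ⟧ t i
  ⟦⟧-+ (con a) s t i = distribˡ a (s i) (t i)
  ⟦⟧-+ X       s t i = refl
  ⟦⟧-+ (p ⊕ r) s t i = trans (+-cong (⟦⟧-+ p s t i) (⟦⟧-+ r s t i))
    (solve 4 (λ a b c d → (a :+ b :+ (c :+ d)) := (a :+ c :+ (b :+ d))) refl _ _ _ _)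
  ⟦⟧-+ (p ⊗ r) s t i = trans (⟦⟧-cong p (⟦⟧-+ r s t) i) (⟦⟧-+ p _ _ i)

  ⟦⟧-scale : ∀ p a s → ⟦ p ⟧ (λ i → a * s i) ≐ λ i → a * ⟦ p ⟧ s i
  ⟦⟧-scale (con b) a s i = solve 3 (λ a b x → (b :* (a :* x)) := (a :* (b :* x))) refl a b (s i)
  ⟦⟧-scale X       a s i = refl
  ⟦⟧-scale (p ⊕ r) a s i = trans (+-cong (⟦⟧-scale p a s i) (⟦⟧-scale r a s i)) (sym (distribˡ a _ _))
  ⟦⟧-scale (p ⊗ r) a s i = trans (⟦⟧-cong p (⟦⟧-scale r a s) i) (⟦⟧-scale p a _ i)

  ⟦⟧-suc : ∀ p s → ⟦ p ⟧ (s ∘ suc) ≐ ⟦ p ⟧ s ∘ suc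
  ⟦⟧-suc (con a) s i = refl
  ⟦⟧-suc X       s i = refl
  ⟦⟧-suc (p ⊕ r) s i = +-cong (⟦⟧-suc p s i) (⟦⟧-suc r s i)
  ⟦⟧-suc (p ⊗ r) s i = trans (⟦⟧-cong p (⟦⟧-suc r s) i) (⟦⟧-suc p (⟦ r ⟧ s) i)

  ⟦⟧-shift : ∀ p n s → ⟦ p ⟧ (λ i → s (n ℕ.+ i)) ≐ λ i → ⟦ p ⟧ s (n ℕ.+ i)
  ⟦⟧-shift p zero    s i = refl
  ⟦⟧-shift p (suc n) s i = trans (⟦⟧-shift p n (s ∘ suc) i) (⟦⟧-suc p s (n ℕ.+ i))

  ⟦⟧-zero : ∀ p → ⟦ p ⟧ (λ _ → 0#) ≐ λ _ → 0#
  ⟦⟧-zero p i = trans (⟦⟧-cong p (λ _ → sym (zeroˡ 0#)) i) (trans (⟦⟧-scale p 0# _ i) (zeroˡ _))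

  -- Constants commute with `r` by linearity and X commutes with it by `⟦⟧-suc`; sums and composites
  -- follow. This makes composition a commutative product.
  ⟦⟧-comm : ∀ p r s → ⟦ p ⟧ (⟦ r ⟧ s) ≐ ⟦ r ⟧ (⟦ p ⟧ s)
  ⟦⟧-comm (con a)  r s i = sym (⟦⟧-scale r a s i)
  ⟦⟧-comm X        r s i = sym (⟦⟧-suc r s i)
  ⟦⟧-comm (p ⊕ p′) r s i = trans (+-cong (⟦⟧-comm p r s i) (⟦⟧-comm p′ r s i)) (sym (⟦⟧-+ r _ _ i))
  ⟦⟧-comm (p ⊗ p′) r s i = trans (⟦⟧-cong p (⟦⟧-comm p′ r s) i) (⟦⟧-comm p r (⟦ p′ ⟧ s) i)

  -- The polynomial with terms cⱼ Xʲ applied to `s`. Unlike the expressions in `Poly`, coefficient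
  -- vectors of a fixed length can be enumerated over a finite field and suit linear algebra.
  comb : ∀ {n} → (Fin n → Carrier) → Seq → Seq
  comb {n} c s i = ∑[ j < n ] (c j * s (toℕ j ℕ.+ i))

  comb-congˡ : ∀ {n} {c c′ : Fin n → Carrier} s → (∀ j → c j ≈ c′ j) → comb c s ≐ comb c′ s
  comb-congˡ {n} s c≈c′ i = sum-cong n λ j → *-congʳ (c≈c′ j)

  comb-congʳ : ∀ {n} (c : Fin n → Carrier) {s t} → s ≐ t → comb c s ≐ comb c t
  comb-congʳ {n} c s≐t i = sum-cong n λ j → *-congˡ (s≐t (toℕ j ℕ.+ i))

  comb-zeroˡ : ∀ n s → comb {n} (λ _ → 0#) s ≐ λ _ → 0#
  comb-zeroˡ n s i = trans (sum-cong n λ j → zeroˡ _) (sum-replicate-zero n)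

  comb-+ : ∀ {n} (c c′ : Fin n → Carrier) s → comb (λ j → c j + c′ j) s ≐ λ i → comb c s i + comb c′ s i
  comb-+ {n} c c′ s i = trans (sum-cong n λ j → distribʳ (s (toℕ j ℕ.+ i)) (c j) (c′ j)) (∑-distrib-+ {n} _ _)

  comb-scale : ∀ {n} a (c : Fin n → Carrier) s → comb (λ j → a * c j) s ≐ λ i → a * comb c s i
  comb-scale {n} a c s i = trans (sum-cong n λ j → *-assoc _ _ _) (sym (*-distribˡ-sum {n} a _))

  comb-sum : ∀ {n l} (a : Fin l → Carrier) (c : Fin l → Fin n → Carrier) s →
    comb (λ j → ∑[ t < l ] (a t * c t j)) s ≐ λ i → ∑[ t < l ] (a t * comb (c t) s i)
  comb-sum {n} {zero}  a c s i = comb-zeroˡ n s i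
  comb-sum {n} {suc l} a c s i = trans
    (comb-+ (λ j → a zero * c zero j) (λ j → ∑[ t < l ] (a (suc t) * c (suc t) j)) s i)
    (+-cong (comb-scale (a zero) (c zero) s i) (comb-sum (a ∘ suc) (c ∘ suc) s i))

  Independent : ℕ → Seq → Set
  Independent n s = ∀ (c : Fin n → Carrier) → comb c s ≐ (λ _ → 0#) → ∀ j → c j ≈ 0#

  comb-injective : ∀ {n} s → Independent n s → (c c′ : Fin n → Carrier) →
    comb c s ≐ comb c′ s → ∀ j → c j ≈ c′ j
  comb-injective {n} s indep c c′ eq j = x∙y⁻¹≈ε⇒x≈y _ _ (trans (+-congˡ (sym (-1*x≈-x _)))
    (indep (λ j → c j + - 1# * c′ j) (λ i → begin
      comb (λ j → c j + - 1# * c′ j) s i         ≈⟨ comb-+ c (λ j → - 1# * c′ j) s i ⟩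
      comb c s i + comb (λ j → - 1# * c′ j) s i  ≈⟨ +-cong (eq i) (trans (comb-scale (- 1#) c′ s i) (-1*x≈-x _)) ⟩
      comb c′ s i - comb c′ s i                  ≈⟨ -‿inverseʳ _ ⟩
      0#                                         ∎) j))

  comb-init-last : ∀ {n} (c : Fin (suc n) → Carrier) s →
    comb c s ≐ λ i → comb (c ∘ inject₁) s i + c (fromℕ n) * s (n ℕ.+ i)
  comb-init-last {n} c s i = trans (sum-init-last (λ j → c j * s (toℕ j ℕ.+ i)))
    (+-cong (sum-cong n λ j → reflexive (≡.cong (λ k → c (inject₁ j) * s (k ℕ.+ i)) (Fin.toℕ-inject₁ j)))
            (reflexive (≡.cong (λ k → c (fromℕ n) * s (k ℕ.+ i)) (Fin.toℕ-fromℕ n))))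

  ⟦⟧-comb : ∀ p {n} (c : Fin n → Carrier) s → ⟦ p ⟧ (comb c s) ≐ comb c (⟦ p ⟧ s)
  ⟦⟧-comb p {zero}  c s i = ⟦⟧-zero p i
  ⟦⟧-comb p {suc n} c s i = begin
    ⟦ p ⟧ (λ k → c zero * s k + ∑[ j < n ] (c (suc j) * s (suc (toℕ j ℕ.+ k)))) i  ≈⟨ ⟦⟧-+ p _ _ i ⟩
    ⟦ p ⟧ (λ k → c zero * s k) i + ⟦ p ⟧ (comb (c ∘ suc) (s ∘ suc)) i
      ≈⟨ +-cong (⟦⟧-scale p (c zero) s i) (trans (⟦⟧-comb p (c ∘ suc) (s ∘ suc) i)
           (comb-congʳ (c ∘ suc) (⟦⟧-suc p s) i)) ⟩
    c zero * ⟦ p ⟧ s i + comb (c ∘ suc) (⟦ p ⟧ s ∘ suc) i ∎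

  combPoly : ∀ {n} → (Fin n → Carrier) → Poly
  combPoly {zero}  c = con 0#
  combPoly {suc n} c = con (c zero) ⊕ combPoly (c ∘ suc) ⊗ X

  ⟦combPoly⟧ : ∀ {n} (c : Fin n → Carrier) s → ⟦ combPoly c ⟧ s ≐ comb c s
  ⟦combPoly⟧ {zero}  c s i = zeroˡ _
  ⟦combPoly⟧ {suc n} c s i = +-congˡ (⟦combPoly⟧ (c ∘ suc) (s ∘ suc) i)

  Span : ℕ → Seq → Seq → Set
  Span n s x = ∃ λ (c : Fin n → Carrier) → x ≐ comb c s

  span-self : ∀ n s → Span (suc n) s s
  span-self n s = δ₀ , λ i → sym (trans (+-cong (*-identityˡ _) (comb-zeroˡ n (s ∘ suc) i)) (+-identityʳ _))
    where
    δ₀ : Fin (suc n) → Carrier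
    δ₀ zero    = 1#
    δ₀ (suc _) = 0#

  module _ {n} (s : Seq) (recurrence : Span n s (λ i → s (n ℕ.+ i))) where

    private
      self : ∀ n → Span n s (λ i → s (n ℕ.+ i)) → Span n s s
      -- A recurrence of order 0 says that `s` vanishes, which is already membership in the empty
      -- span.
      self zero    recurrence = recurrence
      self (suc n) _          = span-self n s

      -- Applying X moves the coefficients up by one, and the recurrence rewrites the top term Xⁿ s
      -- in lower ones.
      shifted : ∀ n → Span n s (λ i → s (n ℕ.+ i)) → ∀ {x} → Span n s x → Span n s (x ∘ suc)
      shifted zero    _ (c , x≐) = c , λ i → x≐ (suc i)
      shifted (suc n) (r , s≐) {x} (c , x≐) = (λ j → c⁺ j + c (fromℕ n) * r j) , λ i → begin
        x (suc i)                                                   ≈⟨ x≐ (suc i) ⟩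
        comb c s (suc i)                                            ≈⟨ comb-init-last c s (suc i) ⟩
        comb (c ∘ inject₁) s (suc i) + c (fromℕ n) * s (n ℕ.+ suc i)
          ≈⟨ +-cong (trans (sum-cong n λ j → *-congˡ (reindex (toℕ j) i))
               (trans (sym (+-identityˡ _)) (+-congʳ (sym (zeroˡ (s i))))))
               (*-congˡ (trans (reindex n i) (s≐ i))) ⟩
        comb c⁺ s i + c (fromℕ n) * comb r s i                      ≈⟨ +-congˡ (comb-scale (c (fromℕ n)) r s i) ⟨
        comb c⁺ s i + comb (λ j → c (fromℕ n) * r j) s i            ≈⟨ comb-+ c⁺ (λ j → c (fromℕ n) * r j) s i ⟨
        comb (λ j → c⁺ j + c (fromℕ n) * r j) s i                   ∎
        where
        c⁺ : Fin (suc n) → Carrier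
        c⁺ zero    = 0#
        c⁺ (suc j) = c (inject₁ j)
        reindex : ∀ k i → s (k ℕ.+ suc i) ≈ s (suc (k ℕ.+ i))
        reindex k i = reflexive (≡.cong s (ℕ.+-suc k i))

    -- The span contains `s` and is stable under constants, X and sums, hence under all polynomials:
    -- this is reduction modulo the recurrence.
    span : ∀ p → Span n s (⟦ p ⟧ s)
    span p = go p (self n recurrence)
      where
      go : ∀ p {x} → Span n s x → Span n s (⟦ p ⟧ x)
      go (con a) (c , x≐) = (λ j → a * c j) , λ i → trans (*-congˡ (x≐ i)) (sym (comb-scale a c s i))
      go X       x∈ = shifted n recurrence x∈
      go (p ⊕ r) x∈ with go p x∈ | go r x∈
      ... | c , p≐ | c′ , r≐ = (λ j → c j + c′ j) , λ i → trans (+-cong (p≐ i) (r≐ i)) (sym (comb-+ c c′ s i))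
      go (p ⊗ r) x∈ = go p (go r x∈)

  -- The ring R[X] modulo the annihilator of w.
  quotientRing : Seq → CommutativeRing 0ℓ 0ℓ
  quotientRing w = record
    { Carrier = Poly
    ; _≈_ = λ p r → ⟦ p ⟧ w ≐ ⟦ r ⟧ w
    ; _+_ = _⊕_
    ; _*_ = _⊗_
    ; -_ = con (- 1#) ⊗_
    ; 0# = con 0#
    ; 1# = con 1#
    ; isCommutativeRing = record
      { isRing = record
        { +-isAbelianGroup = record
          { isGroup = record
            { isMonoid = record
              { isSemigroup = record
                { isMagma = record
                  { isEquivalence = record
                    { refl = λ i → refl
                    ; sym = λ p≈r i → sym (p≈r i)
                    ; trans = λ p≈r r≈t i → trans (p≈r i) (r≈t i)
                    }
                  ; ∙-cong = λ p≈p′ r≈r′ i → +-cong (p≈p′ i) (r≈r′ i)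
                  }
                ; assoc = λ p r t i → +-assoc _ _ _
                }
              ; identity = (λ p i → trans (+-congʳ (zeroˡ _)) (+-identityˡ _))
                         , (λ p i → trans (+-congˡ (zeroˡ _)) (+-identityʳ _))
              }
            ; inverse = (λ p i → trans (+-congʳ (-1*x≈-x _)) (trans (-‿inverseˡ _) (sym (zeroˡ _))))
                      , (λ p i → trans (+-congˡ (-1*x≈-x _)) (trans (-‿inverseʳ _) (sym (zeroˡ _))))
            ; ⁻¹-cong = λ p≈r i → *-congˡ (p≈r i)
            }
          ; comm = λ p r i → +-comm _ _
          }
        ; *-cong = λ {p} {p′} {r} {r′} p≈p′ r≈r′ i → begin
            ⟦ p ⟧ (⟦ r ⟧ w) i    ≈⟨ ⟦⟧-cong p r≈r′ i ⟩
            ⟦ p ⟧ (⟦ r′ ⟧ w) i   ≈⟨ ⟦⟧-comm p r′ w i ⟩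
            ⟦ r′ ⟧ (⟦ p ⟧ w) i   ≈⟨ ⟦⟧-cong r′ p≈p′ i ⟩
            ⟦ r′ ⟧ (⟦ p′ ⟧ w) i  ≈⟨ ⟦⟧-comm r′ p′ w i ⟩
            ⟦ p′ ⟧ (⟦ r′ ⟧ w) i  ∎
        ; *-assoc = λ p r t i → refl
        ; *-identity = (λ p i → *-identityˡ _) , (λ p i → ⟦⟧-cong p (λ k → *-identityˡ (w k)) i)
        ; distrib = (λ p r t i → ⟦⟧-+ p _ _ i) , (λ p r t i → refl)
        }
      ; *-comm = λ p r i → ⟦⟧-comm p r w i
      }
    }

-- Periods of sequences, and a sequence killed by all (Xᴺ - 1)/(X^(N/p) - 1).

primeDivisor : ∀ n .{{_ : NonZero n}} → ¬ n ≡ 1 → ∃ λ p → Prime p × p ∣ n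
primeDivisor n n≢1 with factorise n
... | record { factors = [] ; isFactorisation = eq } = ⊥-elim (n≢1 eq)
... | record { factors = p ∷ ps ; isFactorisation = eq ; factorsPrime = pp ∷ _ } =
  p , pp , divides (product ps) (≡.trans eq (ℕ.*-comm p _))

module PeriodicSequences (R : CommutativeRing 0ℓ 0ℓ) (N : ℕ) .{{_ : NonZero N}} where
  open CommutativeRing R hiding (zero)
  open RingTheory R using (sum-cong; NoZeroDivisors; ×≈×1*)
  open Sequences R
  open import Algebra.Properties.Semiring.Sum semiring
  open import Algebra.Properties.Semiring.Mult semiring using (×1-homo-*; ×-congˡ) renaming (_×_ to _×′_)
  open import Algebra.Properties.Ring ring using (-1*x≈-x)
  open import Relation.Binary.Reasoning.Setoid setoid

  HasPeriod : ℕ → Seq → Set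
  HasPeriod e s = ∀ i → s (e ℕ.+ i) ≈ s i

  period-* : ∀ {e s} → HasPeriod e s → ∀ x → HasPeriod (x ℕ.* e) s
  period-* per zero    i = refl
  period-* {e} {s} per (suc x) i =
    trans (reflexive (≡.cong s (ℕ.+-assoc e (x ℕ.* e) i))) (trans (per _) (period-* per x i))

  period-+⁻ : ∀ {d e s} → HasPeriod e s → HasPeriod (d ℕ.+ e) s → HasPeriod d s
  period-+⁻ {d} {e} {s} pe pde i = begin
    s (d ℕ.+ i)           ≈⟨ pe _ ⟨
    s (e ℕ.+ (d ℕ.+ i))   ≡⟨ ≡.cong s (lemma d e i) ⟩
    s (d ℕ.+ e ℕ.+ i)     ≈⟨ pde i ⟩
    s i                   ∎
    where
    lemma : ∀ d e i → e ℕ.+ (d ℕ.+ i) ≡ d ℕ.+ e ℕ.+ i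
    lemma = solve-∀

  -- Bézout's identity in ℕ writes the gcd as a difference of multiples of the two periods, and
  -- `period-+⁻` subtracts periods.
  period-gcd : ∀ {d e s} → HasPeriod d s → HasPeriod e s → HasPeriod (gcd d e) s
  period-gcd {d} {e} {s} pd pe with Bézout.identity (gcd-GCD d e)
  ... | Bézout.+- x y eq = period-+⁻ (period-* pe y) (≡.subst (λ k → HasPeriod k s) (≡.sym eq) (period-* pd x))
  ... | Bézout.-+ x y eq = period-+⁻ (period-* pd x) (≡.subst (λ k → HasPeriod k s) (≡.sym eq) (period-* pe y))

  -- The factor 1 + Xʳ + … + X⁽ᵖ⁻¹⁾ʳ of Xᴺ - 1, where N = p r, kills s.
  Balanced : ℕ → ℕ → Seq → Set
  Balanced p r s = ∀ i → ∑[ k < p ] s (toℕ k ℕ.* r ℕ.+ i) ≈ 0#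

  ⟦⟧-sum : ∀ p n (t : Fin n → Seq) → ⟦ p ⟧ (λ i → ∑[ k < n ] t k i) ≐ λ i → ∑[ k < n ] ⟦ p ⟧ (t k) i
  ⟦⟧-sum p zero    t i = ⟦⟧-zero p i
  ⟦⟧-sum p (suc n) t i = trans (⟦⟧-+ p _ _ i) (+-congˡ (⟦⟧-sum p n (t ∘ suc) i))

  -- The operator `f` is linear and commutes with shifts, so it commutes with the balancing factor.
  ⟦⟧-balanced : ∀ f {p r s} → Balanced p r s → Balanced p r (⟦ f ⟧ s)
  ⟦⟧-balanced f {p} {r} {s} bal i = begin
    ∑[ k < p ] ⟦ f ⟧ s (toℕ k ℕ.* r ℕ.+ i)               ≈⟨ sum-cong p (λ k → ⟦⟧-shift f (toℕ k ℕ.* r) s i) ⟨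
    ∑[ k < p ] ⟦ f ⟧ (λ i → s (toℕ k ℕ.* r ℕ.+ i)) i     ≈⟨ ⟦⟧-sum f p (λ k i → s (toℕ k ℕ.* r ℕ.+ i)) i ⟨
    ⟦ f ⟧ (λ i → ∑[ k < p ] s (toℕ k ℕ.* r ℕ.+ i)) i     ≈⟨ ⟦⟧-cong f bal i ⟩
    ⟦ f ⟧ (λ _ → 0#) i                                   ≈⟨ ⟦⟧-zero f i ⟩
    0#                                                   ∎

  ⟦⟧-period : ∀ f {e s} → HasPeriod e s → HasPeriod e (⟦ f ⟧ s)
  ⟦⟧-period f {e} {s} per i = trans (sym (⟦⟧-shift f e s i)) (⟦⟧-cong f per i)

  AllBalanced : Seq → Set
  AllBalanced s = ∀ p r → Prime p → p ℕ.* r ≡ N → Balanced p r s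

  -- With `e`, also g = gcd(e, N) is a period, and it is a proper divisor of N. For a prime p
  -- dividing N/g, the number r = N/p is a multiple of g and so a period. The balancing sum for p
  -- then has p equal terms, so p s = 0, where p is nonzero in the ring because N is.
  balanced⇒leastPeriod : NoZeroDivisors → ¬ N ×′ 1# ≈ 0# →
    ∀ {s} → HasPeriod N s → AllBalanced s →
    ∀ {e} → 0 < e → e < N → HasPeriod e s → s ≐ λ _ → 0#
  balanced⇒leastPeriod domain N≉0 {s} perN bal {e} 0<e e<N perE
    with gcd[m,n]∣n e N | gcd[m,n]∣m e N
  ... | divides h N≡hg | g∣e with primeDivisor h {{h≢0}} h≢1
    where
    g = gcd e N
    h≢0 : NonZero h
    h≢0 = ℕ.≢-nonZero λ { ≡.refl → ℕ.≢-nonZero⁻¹ N N≡hg }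
    h≢1 : ¬ h ≡ 1
    h≢1 ≡.refl = ℕ.<⇒≱ e<N (≡.subst (_≤ e) (≡.sym (≡.trans N≡hg (ℕ.*-identityˡ g)))
      (∣⇒≤ {{ℕ.>-nonZero 0<e}} g∣e))
  ... | p , pp , divides t h≡tp = λ i → domain (p*s≈0 i) p≉0
    where
    g = gcd e N
    r = t ℕ.* g
    lemma : ∀ t p g → p ℕ.* (t ℕ.* g) ≡ t ℕ.* p ℕ.* g
    lemma = solve-∀
    pr≡N : p ℕ.* r ≡ N
    pr≡N = ≡.trans (lemma t p g) (≡.trans (≡.cong (ℕ._* g) (≡.sym h≡tp)) (≡.sym N≡hg))
    p≉0 : ¬ p ×′ 1# ≈ 0#
    p≉0 eq = N≉0 (begin
      N ×′ 1#              ≡⟨ ≡.cong (_×′ 1#) pr≡N ⟨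
      (p ℕ.* r) ×′ 1#      ≈⟨ ×1-homo-* p r ⟩
      (p ×′ 1#) * (r ×′ 1#) ≈⟨ *-congʳ eq ⟩
      0# * (r ×′ 1#)       ≈⟨ zeroˡ _ ⟩
      0#                   ∎)
    perR : ∀ x → HasPeriod (x ℕ.* r) s
    perR = period-* (period-* (period-gcd perE perN) t)
    p*s≈0 : ∀ i → (p ×′ 1#) * s i ≈ 0#
    p*s≈0 i = begin
      (p ×′ 1#) * s i                          ≈⟨ ×≈×1* p (s i) ⟨
      p ×′ s i                                 ≈⟨ sum-replicate p ⟨
      ∑[ k < p ] s i                           ≈⟨ sum-cong p (λ k → perR (toℕ k) i) ⟨
      ∑[ k < p ] s (toℕ k ℕ.* r ℕ.+ i)         ≈⟨ bal p r pp pr≡N i ⟩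
      0#                                       ∎

  -- The identity (1 + Xʳ + ... + X⁽ⁿ⁻¹⁾ʳ)(1 - Xʳ) = 1 - Xⁿʳ, which explains why the factor 1 -
  -- X^(N/p) balances a sequence at p.
  telescope : ∀ (s : Seq) r n i →
    ∑[ k < n ] (s (toℕ k ℕ.* r ℕ.+ i) + - 1# * s (r ℕ.+ (toℕ k ℕ.* r ℕ.+ i))) ≈ s i - s (n ℕ.* r ℕ.+ i)
  telescope s r zero    i = sym (-‿inverseʳ (s i))
  telescope s r (suc n) i = begin
    (s i + - 1# * s (r ℕ.+ i)) + ∑[ k < n ] (s (r ℕ.+ toℕ k ℕ.* r ℕ.+ i) + - 1# * s (r ℕ.+ (r ℕ.+ toℕ k ℕ.* r ℕ.+ i)))
      ≈⟨ +-cong (+-congˡ (-1*x≈-x _)) (sum-cong n λ k →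
           reflexive (≡.cong (λ j → s j + - 1# * s (r ℕ.+ j)) (≡.sym (move (toℕ k ℕ.* r) r i)))) ⟩
    (s i - s (r ℕ.+ i)) + ∑[ k < n ] (s (toℕ k ℕ.* r ℕ.+ (r ℕ.+ i)) + - 1# * s (r ℕ.+ (toℕ k ℕ.* r ℕ.+ (r ℕ.+ i))))
      ≈⟨ +-congˡ (telescope s r n (r ℕ.+ i)) ⟩
    (s i - s (r ℕ.+ i)) + (s (r ℕ.+ i) - s (n ℕ.* r ℕ.+ (r ℕ.+ i)))
      ≈⟨ trans (+-assoc _ _ _) (+-congˡ (trans (sym (+-assoc _ _ _)) (trans (+-congʳ (-‿inverseˡ _)) (+-identityˡ _)))) ⟩
    s i - s (n ℕ.* r ℕ.+ (r ℕ.+ i))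
      ≡⟨ ≡.cong (λ j → s i - s j) (move (n ℕ.* r) r i) ⟩
    s i - s (r ℕ.+ n ℕ.* r ℕ.+ i) ∎
    where
    move : ∀ a r i → a ℕ.+ (r ℕ.+ i) ≡ r ℕ.+ a ℕ.+ i
    move = solve-∀

  -- ∏ (1 - X^(N/p)) applied to the indicator of N ℤ, the product running over
  -- the prime divisors p < b of N; modulus is the product of these primes.
  record Partial (b : ℕ) : Set where
    field
      sequence : Seq
      modulus  : ℕ
      period   : HasPeriod N sequence
      initial    : sequence 0 ≈ 1#
      support  : ∀ i → ¬ (N ∣ modulus ℕ.* i) → sequence i ≈ 0#
      primes<b : ∀ p → Prime p → p ∣ modulus → p < b
      balanced : ∀ p r → Prime p → p < b → p ℕ.* r ≡ N → Balanced p r sequence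

  partial : ∀ b → Partial b
  partial zero = record
    { sequence = δ
    ; modulus  = 1
    ; period   = period
    ; initial    = initial
    ; support  = support
    ; primes<b = λ p pp p∣1 → ⊥-elim (¬prime[1] (≡.subst Prime (∣1⇒≡1 p∣1) pp))
    ; balanced = λ p r pp ()
    }
    where
    δ : Seq
    δ i with N ∣? i
    ... | yes _ = 1#
    ... | no  _ = 0#
    δ-yes : ∀ {i} → N ∣ i → δ i ≈ 1#
    δ-yes {i} N∣i with N ∣? i
    ... | yes _ = refl
    ... | no  N∤i = ⊥-elim (N∤i N∣i)
    δ-no : ∀ {i} → ¬ N ∣ i → δ i ≈ 0#
    δ-no {i} N∤i with N ∣? i
    ... | yes N∣i = ⊥-elim (N∤i N∣i)
    ... | no  _ = refl
    initial : δ 0 ≈ 1#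
    initial = δ-yes (N ∣0)
    period : HasPeriod N δ
    period i with N ∣? i
    ... | yes N∣i = δ-yes (∣m∣n⇒∣m+n n∣n N∣i)
    ... | no  N∤i = δ-no (N∤i ∘ λ N∣N+i → ∣m+n∣m⇒∣n N∣N+i n∣n)
    support : ∀ i → ¬ (N ∣ 1 ℕ.* i) → δ i ≈ 0#
    support i N∤ = δ-no (N∤ ∘ ≡.subst (N ∣_) (≡.sym (ℕ.*-identityˡ i)))
  partial (suc b) with prime? b | b ∣? N
  ... | no ¬pb | _ = record
    { Partial P
    ; primes<b = λ p pp p∣M → ℕ.m<n⇒m<1+n (Partial.primes<b P p pp p∣M)
    ; balanced = λ p r pp p<1+b → Partial.balanced P p r pp
        (ℕ.≤∧≢⇒< (ℕ.≤-pred p<1+b) λ { ≡.refl → ¬pb pp })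
    }
    where P = partial b
  ... | yes pb | no b∤N = record
    { Partial P
    ; primes<b = λ p pp p∣M → ℕ.m<n⇒m<1+n (Partial.primes<b P p pp p∣M)
    ; balanced = λ p r pp p<1+b pr≡N → Partial.balanced P p r pp
        (ℕ.≤∧≢⇒< (ℕ.≤-pred p<1+b) λ { ≡.refl → b∤N (divides r (≡.trans (≡.sym pr≡N) (ℕ.*-comm p r))) }) pr≡N
    }
    where P = partial b
  ... | yes pb | yes (divides r N≡rb) = record
    { sequence = λ i → s i + - 1# * s (r ℕ.+ i)
    ; modulus  = b ℕ.* M
    ; period   = λ i → +-cong (P.period i) (*-congˡ (trans (reflexive (≡.cong s (+-swap r N i))) (P.period (r ℕ.+ i))))
    -- The new term at 0 is s(0) - s(r), where r = N/b. By `support`, s(r) = 0: if N = b r divided M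
    -- r, then b would divide M, although the primes dividing M are below b.
    ; initial    = trans (+-cong P.initial (trans (*-congˡ (P.support (r ℕ.+ 0) N∤Mr)) (zeroʳ _))) (+-identityʳ 1#)
    -- If N divides M (r + i), it divides b M (r + i) = M N + b M i, hence also b M i.
    ; support  = λ i N∤ → trans (+-cong (P.support i λ N∣ → N∤ (≡.subst (N ∣_) (≡.sym (ℕ.*-assoc b M i)) (∣n⇒∣m*n b N∣)))
        (trans (*-congˡ (P.support (r ℕ.+ i) λ N∣ → N∤
          (∣m+n∣m⇒∣n (≡.subst (N ∣_) (expand b M r i) (∣n⇒∣m*n b N∣))
            (∣n⇒∣m*n M (≡.subst (N ∣_) N≡rb n∣n))))) (zeroʳ _))) (+-identityʳ 0#)
    ; primes<b = primes<
    ; balanced = bal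
    }
    where
    module P = Partial (partial b)
    s = P.sequence
    M = P.modulus
    instance _ = prime⇒nonZero pb
    instance
      r≢0 : NonZero r
      r≢0 = ℕ.≢-nonZero λ { ≡.refl → ℕ.≢-nonZero⁻¹ N N≡rb }
    +-swap : ∀ r n i → r ℕ.+ (n ℕ.+ i) ≡ n ℕ.+ (r ℕ.+ i)
    +-swap = solve-∀
    expand : ∀ b M r i → b ℕ.* (M ℕ.* (r ℕ.+ i)) ≡ M ℕ.* (r ℕ.* b) ℕ.+ b ℕ.* M ℕ.* i
    expand = solve-∀
    br≡N : b ℕ.* r ≡ N
    br≡N = ≡.trans (ℕ.*-comm b r) (≡.sym N≡rb)
    N∤Mr : ¬ N ∣ M ℕ.* (r ℕ.+ 0)
    N∤Mr N∣ = ℕ.<-irrefl ≡.refl (P.primes<b b pb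
      (*-cancelʳ-∣ r (≡.subst₂ _∣_ (≡.sym br≡N) (≡.cong (M ℕ.*_) (ℕ.+-identityʳ r)) N∣)))
    primes< : ∀ p → Prime p → p ∣ b ℕ.* M → p < suc b
    primes< p pp p∣bM with euclidsLemma b M pp p∣bM
    ... | inj₁ p∣b = s≤s (∣⇒≤ p∣b)
    ... | inj₂ p∣M = ℕ.m<n⇒m<1+n (P.primes<b p pp p∣M)
    -- At p = b the sum telescopes to 1 - Xᴺ, which kills an N-periodic sequence. At smaller p the
    -- sum vanishes on s and on its shift.
    bal : ∀ p r′ → Prime p → p < suc b → p ℕ.* r′ ≡ N → Balanced p r′ (λ i → s i + - 1# * s (r ℕ.+ i))
    bal p r′ pp p<1+b pr′≡N i with p ℕ.≟ b
    ... | yes ≡.refl with ℕ.*-cancelˡ-≡ r′ r b (≡.trans pr′≡N (≡.sym br≡N))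
    ...   | ≡.refl = begin
      ∑[ k < b ] (s (toℕ k ℕ.* r ℕ.+ i) + - 1# * s (r ℕ.+ (toℕ k ℕ.* r ℕ.+ i))) ≈⟨ telescope s r b i ⟩
      s i - s (b ℕ.* r ℕ.+ i)   ≡⟨ ≡.cong (λ n → s i - s (n ℕ.+ i)) br≡N ⟩
      s i - s (N ℕ.+ i)         ≈⟨ +-congˡ (-‿cong (P.period i)) ⟩
      s i - s i                 ≈⟨ -‿inverseʳ _ ⟩
      0#                        ∎
    bal p r′ pp p<1+b pr′≡N i | no p≢b = begin
      ∑[ k < p ] (s (toℕ k ℕ.* r′ ℕ.+ i) + - 1# * s (r ℕ.+ (toℕ k ℕ.* r′ ℕ.+ i)))
        ≈⟨ ∑-distrib-+ {p} (λ k → s (toℕ k ℕ.* r′ ℕ.+ i)) _ ⟩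
      ∑[ k < p ] s (toℕ k ℕ.* r′ ℕ.+ i) + ∑[ k < p ] (- 1# * s (r ℕ.+ (toℕ k ℕ.* r′ ℕ.+ i)))
        ≈⟨ +-cong (B i) (trans (sym (*-distribˡ-sum {p} (- 1#) _)) (*-congˡ (trans
             (sum-cong p λ k → reflexive (≡.cong s (+-swap r (toℕ k ℕ.* r′) i))) (B (r ℕ.+ i))))) ⟩
      0# + - 1# * 0#   ≈⟨ trans (+-identityˡ _) (zeroʳ _) ⟩
      0#               ∎
      where
      B = P.balanced p r′ pp (ℕ.≤∧≢⇒< (ℕ.≤-pred p<1+b) p≢b) pr′≡N

  abstract
    -- A prime divisor of N is below N + 1, so all factors are present at stage `suc N`.
    balancedSequence : ∃ λ s → HasPeriod N s × s 0 ≈ 1# × AllBalanced s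
    balancedSequence = P.sequence , P.period , P.initial , λ p r pp pr≡N →
      P.balanced p r pp (s≤s (∣⇒≤ (divides r (≡.trans (≡.sym pr≡N) (ℕ.*-comm p r))))) pr≡N
      where module P = Partial (partial (suc N))

-- A recurring sequence of order d whose shifts are all nonzero elements of their span.

least : ∀ {P : ℕ → Set} → (∀ n → Dec (P n)) → ∀ {n} → P n → ∃ λ k → P k × (∀ j → j < k → ¬ P j)
least {P} P? {n} Pn = go n 0 (ℕ.+-identityʳ n) (λ _ ())
  where
  go : ∀ fuel k → fuel ℕ.+ k ≡ n → (∀ j → j < k → ¬ P j) → ∃ λ k → P k × (∀ j → j < k → ¬ P j)
  go zero       k ≡.refl none = k , Pn , none
  go (suc fuel) k eq none with P? k
  ... | yes Pk = k , Pk , none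
  ... | no ¬Pk = go fuel (suc k) (≡.trans (ℕ.+-suc fuel k) eq) none′
    where
    none′ : ∀ j → j < suc k → ¬ P j
    none′ j j<1+k with j ℕ.≟ k
    ... | yes ≡.refl = ¬Pk
    ... | no  j≢k    = none j (ℕ.≤∧≢⇒< (ℕ.≤-pred j<1+k) j≢k)

module PrimitiveSequences (F : Field) (m : ℕ) (size : HasSize F (suc (suc m)))
  (n d : ℕ) (N+1≡q^d : suc (suc n) ≡ suc (suc m) ℕ.^ d) where

  N : ℕ
  N = suc n

  open Field F hiding (zero)
  open FiniteField F m size
  open Sequences commRing
  open PeriodicSequences commRing N
  open import Algebra.Properties.Semiring.Mult semiring using (×1-homo-*) renaming (_×_ to _×′_)
  open import Algebra.Properties.CommutativeSemiring.Exp commutativeSemiring using (^-assocʳ; ^-congˡ) renaming (_^_ to _^ᶠ_)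
  open import Algebra.Properties.Ring ring using (-1*x≈-x)
  open import Algebra.Properties.Group +-group using (inverseʳ-unique)
  open import Relation.Binary.Reasoning.Setoid setoid

  -- The counterpart of a primitive element: by `transitive`, the shifts of `s` exhaust the nonzero
  -- elements of the `e`-dimensional space that they span.
  record IsPrimitive (e : ℕ) (s : Seq) : Set where
    field
      period      : HasPeriod N s
      recurrent   : ∀ k → Span e s (λ i → s (k ℕ.+ i))
      independent : Independent e s
      transitive  : ∀ (c : Fin e → Carrier) →
                    comb c s ≐ (λ _ → 0#) ⊎ ∃ λ (r : Fin N) → comb c s ≐ λ i → s (toℕ r ℕ.+ i)

  -- In the field N + 1 = q^d is zero, so N = -1. The exponent d is positive because q^d is at least
  -- 2.
  N×1≉0 : ¬ N ×′ 1# ≈ 0#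
  N×1≉0 N≈0 = 0≉1 (begin
    0#                  ≈⟨ q^d×1≈0 d N+1≡q^d ⟨
    (q ℕ.^ d) ×′ 1#     ≡⟨ ≡.cong (_×′ 1#) N+1≡q^d ⟨
    1# + N ×′ 1#        ≈⟨ +-congˡ N≈0 ⟩
    1# + 0#             ≈⟨ +-identityʳ 1# ⟩
    1#                  ∎)
    where
    q^d×1≈0 : ∀ d → suc (suc n) ≡ q ℕ.^ d → (q ℕ.^ d) ×′ 1# ≈ 0#
    q^d×1≈0 (suc d) _ = trans (×1-homo-* q (q ℕ.^ d)) (trans (*-congʳ size×1≈0) (zeroˡ _))

  ^q^k-fixed : ∀ k a → a ^ᶠ (q ℕ.^ k) ≈ a
  ^q^k-fixed zero    a = *-identityʳ a
  ^q^k-fixed (suc k) a = trans (sym (^-assocʳ a q (q ℕ.^ k)))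
    (trans (^-congˡ (q ℕ.^ k) (fermat a)) (^q^k-fixed k a))

  period-≐ : ∀ {s t} → HasPeriod N s → HasPeriod N t → (∀ (i : Fin N) → s (toℕ i) ≈ t (toℕ i)) → s ≐ t
  period-≐ {s} {t} ps pt s≈t i = begin
    s i                         ≈⟨ reduce s ps ⟩
    s (i % N)                   ≡⟨ ≡.cong s (Fin.toℕ-fromℕ< (m%n<n i N)) ⟨
    s (toℕ (fromℕ< (m%n<n i N))) ≈⟨ s≈t _ ⟩
    t (toℕ (fromℕ< (m%n<n i N))) ≡⟨ ≡.cong t (Fin.toℕ-fromℕ< (m%n<n i N)) ⟩
    t (i % N)                   ≈⟨ reduce t pt ⟨
    t i                         ∎
    where
    reduce : ∀ u → HasPeriod N u → u i ≈ u (i % N)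
    reduce u pu = trans (reflexive (≡.cong u (≡.trans (m≡m%n+[m/n]*n i N) (ℕ.+-comm (i % N) _))))
      (period-* pu (i / N) (i % N))

  period-≐? : ∀ {s t} → HasPeriod N s → HasPeriod N t → Dec (s ≐ t)
  period-≐? ps pt = map′ (period-≐ ps pt) (λ s≐t i → s≐t (toℕ i)) (Fin.all? λ i → _ ≟ _)

  v : Seq
  v = proj₁ balancedSequence

  v-period : HasPeriod N v
  v-period = proj₁ (proj₂ balancedSequence)

  v-initial : v 0 ≈ 1#
  v-initial = proj₁ (proj₂ (proj₂ balancedSequence))

  v-balanced : AllBalanced v
  v-balanced = proj₂ (proj₂ (proj₂ balancedSequence))

  Satisfies : ℕ → Seq → Set
  Satisfies k s = Span k s (λ i → s (k ℕ.+ i))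

  period⇒satisfies : ∀ {s} → HasPeriod N s → Satisfies N s
  period⇒satisfies {s} ps with span-self n s
  ... | c , s≐ = c , λ i → trans (ps i) (s≐ i)

  -- Since v has period N, polynomials with N coefficients already reach all of F[X] v, as
  -- `recurrent-intro` shows. The finite range makes the property decidable.
  Recurrent : ℕ → Set
  Recurrent k = ∃ λ (a : Fin N → Carrier) → let s = ⟦ combPoly a ⟧ v in ¬ s ≐ (λ _ → 0#) × Satisfies k s

  satisfies-resp : ∀ {k s t} → s ≐ t → Satisfies k s → Satisfies k t
  satisfies-resp {k} s≐t (c , rec) = c , λ i → trans (sym (s≐t (k ℕ.+ i))) (trans (rec i) (comb-congʳ c s≐t i))

  recurrent? : ∀ k → Dec (Recurrent k)
  recurrent? k = search
    (λ a → ¬ ⟦ combPoly a ⟧ v ≐ (λ _ → 0#) × Satisfies k (⟦ combPoly a ⟧ v))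
    (λ {a} {b} a≈b (≢0 , sat) →
      let eq : ⟦ combPoly a ⟧ v ≐ ⟦ combPoly b ⟧ v
          eq i = trans (⟦combPoly⟧ a v i) (trans (comb-congˡ v a≈b i) (sym (⟦combPoly⟧ b v i)))
      in (λ ≐0 → ≢0 λ i → trans (eq i) (≐0 i)) , satisfies-resp eq sat)
    (λ a → let s = ⟦ combPoly a ⟧ v ; ps = ⟦⟧-period (combPoly a) v-period in
      ¬? (period-≐? ps (λ _ → refl)) ×-dec
      search (λ c → (λ i → s (k ℕ.+ i)) ≐ comb c s)
        (λ c≈c′ eq i → trans (eq i) (comb-congˡ s c≈c′ i))
        (λ c → map′
          (λ eq i → trans (eq i) (⟦combPoly⟧ c s i))
          (λ eq i → trans (eq i) (sym (⟦combPoly⟧ c s i)))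
          (period-≐? {λ i → s (k ℕ.+ i)} (λ i → trans (reflexive (≡.cong s (swap k N i))) (ps (k ℕ.+ i))) (⟦⟧-period (combPoly c) ps))))
    where
    swap : ∀ a b i → a ℕ.+ (b ℕ.+ i) ≡ b ℕ.+ (a ℕ.+ i)
    swap = solve-∀

  recurrent-intro : ∀ f {k} → ¬ ⟦ f ⟧ v ≐ (λ _ → 0#) → Satisfies k (⟦ f ⟧ v) → Recurrent k
  recurrent-intro f {k} ≢0 sat with span v (period⇒satisfies v-period) f
  ... | a , f≐ = a , (λ ≐0 → ≢0 λ i → trans (eq i) (≐0 i)) , satisfies-resp eq sat
    where
    eq : ⟦ f ⟧ v ≐ ⟦ combPoly a ⟧ v
    eq i = trans (f≐ i) (sym (⟦combPoly⟧ a v i))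

  abstract
    leastRecurrence : ∃ λ k → Recurrent k × (∀ j → j < k → ¬ Recurrent j)
    -- The search is bounded by N: v itself satisfies a recurrence of order N and is nonzero because
    -- its term at 0 is 1.
    leastRecurrence = least recurrent? (recurrent-intro (con 1#)
      (λ ≐0 → 0≉1 (trans (sym (≐0 0)) (trans (*-identityˡ _) v-initial)))
      (period⇒satisfies (⟦⟧-period (con 1#) v-period)))

  -- The degree of the field extension generated by a primitive N-th root of
  -- unity; it turns out to be d.
  D : ℕ
  D = proj₁ leastRecurrence

  generator : Poly
  generator = combPoly (proj₁ (proj₁ (proj₂ leastRecurrence)))

  w : Seq
  w = ⟦ generator ⟧ v

  w≢0 : ¬ w ≐ (λ _ → 0#)
  w≢0 = proj₁ (proj₂ (proj₁ (proj₂ leastRecurrence)))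

  w-satisfies : Satisfies D w
  w-satisfies = proj₂ (proj₂ (proj₁ (proj₂ leastRecurrence)))

  D-least : ∀ j → j < D → ¬ Recurrent j
  D-least = proj₂ (proj₂ leastRecurrence)

  w-period : HasPeriod N w
  w-period = ⟦⟧-period generator v-period

  w-balanced : AllBalanced w
  w-balanced p r pp pr≡N = ⟦⟧-balanced generator {p} {r} {v} (v-balanced p r pp pr≡N)

  -- A relation with nonzero top coefficient could be solved for the top shift, giving a recurrence
  -- of order below D. So the top coefficient is zero, and induction removes the others. The lemma
  -- covers every nonzero `f` v because `K-domain` applies it to multiples of w.
  independent : ∀ f → ¬ ⟦ f ⟧ v ≐ (λ _ → 0#) → ∀ {k} → k ≤ D → (c : Fin k → Carrier) →
    comb c (⟦ f ⟧ v) ≐ (λ _ → 0#) → ∀ j → c j ≈ 0#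
  independent f ≢0 {suc k} k<D c comb≐0 = by-view
    where
    x = ⟦ f ⟧ v
    cₗ = c (fromℕ k)
    decomposed : ∀ i → comb (c ∘ inject₁) x i + cₗ * x (k ℕ.+ i) ≈ 0#
    decomposed i = trans (sym (comb-init-last c x i)) (comb≐0 i)
    cₗ≈0 : cₗ ≈ 0#
    cₗ≈0 with cₗ ≟ 0#
    ... | yes eq = eq
    ... | no cₗ≉0 with inverse cₗ cₗ≉0
    ...   | b , cₗb≈1 = ⊥-elim (D-least k k<D (recurrent-intro f ≢0 ((λ j → (b * - 1#) * c (inject₁ j)) , λ i → begin
      x (k ℕ.+ i)               ≈⟨ *-identityˡ _ ⟨
      1# * x (k ℕ.+ i)          ≈⟨ *-congʳ (trans (*-comm b cₗ) cₗb≈1) ⟨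
      b * cₗ * x (k ℕ.+ i)      ≈⟨ *-assoc _ _ _ ⟩
      b * (cₗ * x (k ℕ.+ i))    ≈⟨ *-congˡ (inverseʳ-unique _ _ (decomposed i)) ⟩
      b * - comb (c ∘ inject₁) x i          ≈⟨ *-congˡ (-1*x≈-x _) ⟨
      b * (- 1# * comb (c ∘ inject₁) x i)   ≈⟨ *-assoc _ _ _ ⟨
      b * - 1# * comb (c ∘ inject₁) x i     ≈⟨ comb-scale (b * - 1#) (c ∘ inject₁) x i ⟨
      comb (λ j → (b * - 1#) * c (inject₁ j)) x i ∎)))
    init≈0 : ∀ j → c (inject₁ j) ≈ 0#
    init≈0 = independent f ≢0 {k} (ℕ.<⇒≤ k<D) (c ∘ inject₁) λ i → trans (sym (trans (+-congˡ
      (trans (*-congʳ cₗ≈0) (zeroˡ _))) (+-identityʳ _))) (decomposed i)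
    by-view : ∀ j → c j ≈ 0#
    by-view j with view j
    ... | ‵fromℕ     = cₗ≈0
    ... | ‵inject₁ i = init≈0 i

  -- The domain F[X]/Ann(w) and the bound D ≤ d.

  K : CommutativeRing _ _
  K = quotientRing w

  private
    module K where
      open CommutativeRing K public
      open RingTheory K public
      open import Algebra.Properties.Semiring.Mult (CommutativeRing.semiring K) public renaming (_×_ to _×′_)
      open import Algebra.Properties.CommutativeSemiring.Exp (CommutativeRing.commutativeSemiring K) public using (_^_; ^-distrib-*)

  K≈0⇒ : ∀ p → p K.≈ K.0# → ⟦ p ⟧ w ≐ λ _ → 0#
  K≈0⇒ p p≈0 i = trans (p≈0 i) (zeroˡ _)

  ⇒K≈0 : ∀ p → ⟦ p ⟧ w ≐ (λ _ → 0#) → p K.≈ K.0#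
  ⇒K≈0 p p≐0 i = trans (p≐0 i) (sym (zeroˡ _))

  -- Reduce r w to a combination c of the first D shifts of w. The same combination of the shifts of
  -- p w is p r w = 0, and p w is nonzero, so `independent` gives c = 0 and hence r w = 0.
  K-domain : K.NoZeroDivisors
  K-domain {p} {r} pr≈0 p≉0 with span w w-satisfies r
  ... | c , r≐ = ⇒K≈0 r λ i → trans (r≐ i) (trans (comb-congˡ w c≈0 i) (comb-zeroˡ D w i))
    where
    c≈0 : ∀ j → c j ≈ 0#
    c≈0 = independent (p ⊗ generator) (p≉0 ∘ ⇒K≈0 p) ℕ.≤-refl c λ i → begin
      comb c (⟦ p ⟧ w) i  ≈⟨ ⟦⟧-comb p c w i ⟨
      ⟦ p ⟧ (comb c w) i  ≈⟨ ⟦⟧-cong p r≐ i ⟨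
      ⟦ p ⟧ (⟦ r ⟧ w) i   ≈⟨ K≈0⇒ (p ⊗ r) pr≈0 i ⟩
      0#                  ∎

  K-nontrivial : ¬ K.1# K.≈ K.0#
  K-nontrivial 1≈0 = w≢0 λ i → trans (sym (*-identityˡ _)) (K≈0⇒ K.1# 1≈0 i)

  w-independent : Independent D w
  w-independent = independent generator w≢0 ℕ.≤-refl

  K-×′ : ∀ k → k K.×′ K.1# K.≈ con (k ×′ 1#)
  K-×′ zero    i = refl
  K-×′ (suc k) i = trans (+-congˡ (K-×′ k i)) (sym (distribʳ (w i) 1# (k ×′ 1#)))

  K-con-^ : ∀ a k → con a K.^ k K.≈ con (a ^ᶠ k)
  K-con-^ a zero    i = refl
  K-con-^ a (suc k) i = trans (*-congˡ (K-con-^ a k i)) (sym (*-assoc _ _ _))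

  ⟦X^⟧ : ∀ k s → ⟦ X K.^ k ⟧ s ≐ λ i → s (k ℕ.+ i)
  ⟦X^⟧ zero    s i = *-identityˡ _
  ⟦X^⟧ (suc k) s i = trans (⟦X^⟧ k s (suc i)) (reflexive (≡.cong s (ℕ.+-suc k i)))

  K-binomial≈0 : ∀ (j : Fin (suc m)) → (q C suc (toℕ j)) K.×′ K.1# K.≈ K.0#
  K-binomial≈0 j i = trans (K-×′ (q C suc (toℕ j)) i) (*-congʳ (binomial≈0 j))

  -- Constants are fixed by Fermat's theorem, and X because X^(N+1) w = X w by periodicity. Fixed
  -- elements are closed under sums by Frobenius and under products.
  K-fixed : ∀ p → p K.^ (q ℕ.^ d) K.≈ p
  K-fixed (con a) i = trans (K-con-^ a (q ℕ.^ d) i) (*-congʳ (^q^k-fixed d a))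
  K-fixed X       i = begin
    ⟦ X K.^ (q ℕ.^ d) ⟧ w i  ≈⟨ ⟦X^⟧ (q ℕ.^ d) w i ⟩
    w (q ℕ.^ d ℕ.+ i)        ≡⟨ ≡.cong (λ k → w (k ℕ.+ i)) N+1≡q^d ⟨
    w (suc N ℕ.+ i)          ≡⟨ ≡.cong w (ℕ.+-suc N i) ⟨
    w (N ℕ.+ suc i)          ≈⟨ w-period (suc i) ⟩
    w (suc i)                ∎
  K-fixed (p ⊕ r) i = trans (K.frobenius-iterate (suc m) K-binomial≈0 d p r i) (+-cong (K-fixed p i) (K-fixed r i))
  K-fixed (p ⊗ r) i = trans (K.^-distrib-* p r (q ℕ.^ d) i)
    (K.*-cong {p K.^ (q ℕ.^ d)} {p} {r K.^ (q ℕ.^ d)} {r} (K-fixed p) (K-fixed r) i)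

  combPoly-injective : ∀ (c c′ : Fin D → Carrier) → combPoly c K.≈ combPoly c′ → ∀ j → c j ≈ c′ j
  combPoly-injective c c′ eq = comb-injective w w-independent c c′ λ k →
    trans (sym (⟦combPoly⟧ c w k)) (trans (eq k) (⟦combPoly⟧ c′ w k))

  -- If d < D, then K has at least q^d + 1 = n + 3 distinct elements, all of them roots of Z^(q^d) -
  -- Z.
  D≤d : D ≤ d
  D≤d = ℕ.≮⇒≥ too-many
    where
    module _ (d<D : d < D) where
      bound : suc (suc (suc n)) ≤ q ℕ.^ D
      bound = ≡.subst (_< q ℕ.^ D) (≡.sym N+1≡q^d) (ℕ.^-monoʳ-< q (s≤s (s≤s z≤n)) d<D)

      coefficients : Fin (suc (suc (suc n))) → Fin D → Carrier
      coefficients i = decode (inject≤ i bound)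

      point : Fin (suc (suc (suc n))) → Poly
      point i = combPoly (coefficients i)

      point-injective : ∀ {i j} → point i K.≈ point j → i ≡ j
      point-injective {i} {j} eq = Fin.inject≤-injective bound bound i j
        (decode-injective (combPoly-injective (coefficients i) (coefficients j) eq))

      point-fixed : ∀ i → point i K.^ suc (suc n) K.≈ point i
      point-fixed i k = trans (reflexive (≡.cong (λ e → ⟦ point i K.^ e ⟧ w k) N+1≡q^d)) (K-fixed (point i) k)

    too-many : ¬ d < D
    too-many d<D = K.few-fixed-points (λ {p} {r} → K-domain {p} {r}) K-nontrivial n
      (point d<D) (point-injective d<D) (point-fixed d<D)

  -- The orbit of w under the shift and the bound d ≤ D.

  shift-span : ∀ k → Span D w (λ i → w (k ℕ.+ i))
  shift-span k with span w w-satisfies (X K.^ k)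
  ... | c , eq = c , λ i → trans (sym (⟦X^⟧ k w i)) (eq i)

  -- As k + k n = k N, the shift by `k * n` undoes the shift by `k`; this stands in for negative
  -- shifts.
  unshift : ∀ k {s} → HasPeriod N s → ∀ i → s (k ℕ.+ (k ℕ.* n ℕ.+ i)) ≈ s i
  unshift k {s} ps i = trans (reflexive (≡.cong s (≡.trans (≡.sym (ℕ.+-assoc k (k ℕ.* n) i))
    (≡.cong (ℕ._+ i) (≡.sym (ℕ.*-suc k n)))))) (period-* ps k i)

  -- Undoing the shift by j would make k - j a positive period below N.
  shifts≢ : ∀ {j k} → j < k → k < N → ¬ (λ i → w (j ℕ.+ i)) ≐ (λ i → w (k ℕ.+ i))
  shifts≢ {j} {k} j<k k<N eq = w≢0 (balanced⇒leastPeriod noZeroDivisors N×1≉0 w-period w-balanced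
    (ℕ.m<n⇒0<n∸m j<k) (ℕ.≤-<-trans (ℕ.m∸n≤m k j) k<N) λ i → begin
      w (e ℕ.+ i)                         ≈⟨ unshift j w-period (e ℕ.+ i) ⟨
      w (j ℕ.+ (j ℕ.* n ℕ.+ (e ℕ.+ i)))   ≡⟨ ≡.cong w (≡.trans (move j e (j ℕ.* n) i) (≡.cong (ℕ._+ (j ℕ.* n ℕ.+ i)) (ℕ.m∸n+n≡m (ℕ.<⇒≤ j<k)))) ⟩
      w (k ℕ.+ (j ℕ.* n ℕ.+ i))           ≈⟨ eq _ ⟨
      w (j ℕ.+ (j ℕ.* n ℕ.+ i))           ≈⟨ unshift j w-period i ⟩
      w i                                 ∎)
    where
    e = k ℕ.∸ j
    move : ∀ j e a i → j ℕ.+ (a ℕ.+ (e ℕ.+ i)) ≡ e ℕ.+ j ℕ.+ (a ℕ.+ i)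
    move = solve-∀

  shifts-injective : ∀ {j k} → j < N → k < N → (λ i → w (j ℕ.+ i)) ≐ (λ i → w (k ℕ.+ i)) → j ≡ k
  shifts-injective {j} {k} j<N k<N eq with ℕ.<-cmp j k
  ... | tri< j<k _ _ = ⊥-elim (shifts≢ j<k k<N eq)
  ... | tri≈ _ j≡k _ = j≡k
  ... | tri> _ _ k<j = ⊥-elim (shifts≢ k<j j<N (λ i → sym (eq i)))

  coordinates : Fin N → Fin D → Carrier
  coordinates r = proj₁ (shift-span (toℕ r))

  comb-coordinates : ∀ r → comb (coordinates r) w ≐ λ i → w (toℕ r ℕ.+ i)
  comb-coordinates r i = sym (proj₂ (shift-span (toℕ r)) i)

  code-comb : ∀ (c c′ : Fin D → Carrier) → code c ≡ code c′ → comb c w ≐ comb c′ w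
  code-comb c c′ eq = comb-congˡ w (code-injective {D} {c} {c′} eq)

  -- The zero sequence and the N shifts of w, given by the codes of their coordinates. These are N +
  -- 1 = q^d elements of a space with q^D elements; injectivity gives d ≤ D.
  orbit : Fin (suc N) → Fin (q ℕ.^ D)
  orbit zero    = code {D} (λ _ → 0#)
  orbit (suc r) = code (coordinates r)

  orbit-injective : ∀ {i j} → orbit i ≡ orbit j → i ≡ j
  orbit-injective {zero}  {zero}  _  = ≡.refl
  orbit-injective {zero}  {suc r} eq = ⊥-elim (zero≢shift r eq)
    where
    zero≢shift : ∀ r → ¬ orbit zero ≡ orbit (suc r)
    zero≢shift r eq = w≢0 λ i → begin
      w i                                     ≈⟨ unshift (toℕ r) w-period i ⟨
      w (toℕ r ℕ.+ (toℕ r ℕ.* n ℕ.+ i))       ≈⟨ comb-coordinates r _ ⟨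
      comb (coordinates r) w (toℕ r ℕ.* n ℕ.+ i)  ≈⟨ code-comb (λ _ → 0#) (coordinates r) eq _ ⟨
      comb {D} (λ _ → 0#) w (toℕ r ℕ.* n ℕ.+ i) ≈⟨ comb-zeroˡ D w _ ⟩
      0#                                      ∎
  orbit-injective {suc r} {zero}  eq with orbit-injective {zero} {suc r} (≡.sym eq)
  ... | ()
  orbit-injective {suc r} {suc t} eq = ≡.cong suc (Fin.toℕ-injective (shifts-injective (Fin.toℕ<n r) (Fin.toℕ<n t) λ i →
    trans (sym (comb-coordinates r i)) (trans (code-comb (coordinates r) (coordinates t) eq i) (comb-coordinates t i))))

  d≤D : d ≤ D
  d≤D = ℕ.≮⇒≥ λ D<d → ℕ.<⇒≱ (ℕ.^-monoʳ-< q (s≤s (s≤s z≤n)) D<d)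
    (≡.subst (_≤ q ℕ.^ D) N+1≡q^d (Fin.injective⇒≤ orbit-injective))

  -- Now D = d, so `orbit` is an injection between sets of equal size. A missed `x` could be
  -- adjoined to make an injection from a larger set.
  orbit-surjective : ∀ x → ∃ λ i → orbit i ≡ x
  orbit-surjective x with Fin.any? (λ i → orbit i Fin.≟ x)
  ... | yes found = found
  ... | no  x∉    = ⊥-elim (ℕ.<⇒≱ (ℕ.≤-reflexive (≡.cong suc (≡.sym size≡))) (Fin.injective⇒≤ {f = extended} extended-injective))
    where
    size≡ : suc N ≡ q ℕ.^ D
    size≡ = ≡.trans N+1≡q^d (≡.cong (q ℕ.^_) (ℕ.≤-antisym d≤D D≤d))
    extended : Fin (suc (suc N)) → Fin (q ℕ.^ D)
    extended zero    = x
    extended (suc i) = orbit i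
    extended-injective : ∀ {i j} → extended i ≡ extended j → i ≡ j
    extended-injective {zero}  {zero}  _  = ≡.refl
    extended-injective {zero}  {suc j} eq = ⊥-elim (x∉ (j , ≡.sym eq))
    extended-injective {suc i} {zero}  eq = ⊥-elim (x∉ (i , eq))
    extended-injective {suc i} {suc j} eq = ≡.cong suc (orbit-injective eq)

  w-transitive : ∀ (c : Fin D → Carrier) →
    comb c w ≐ (λ _ → 0#) ⊎ ∃ λ (r : Fin N) → comb c w ≐ λ i → w (toℕ r ℕ.+ i)
  w-transitive c with orbit-surjective (code c)
  ... | zero  , eq = inj₁ λ i → trans (code-comb c (λ _ → 0#) (≡.sym eq) i) (comb-zeroˡ D w i)
  ... | suc r , eq = inj₂ (r , λ i → trans (code-comb c (coordinates r) (≡.sym eq) i) (comb-coordinates r i))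

  w-primitive : IsPrimitive D w
  w-primitive = record
    { period      = w-period
    ; recurrent   = shift-span
    ; independent = w-independent
    ; transitive  = w-transitive
    }

  abstract
    primitiveSequence : ∃ (IsPrimitive d)
    primitiveSequence = w , ≡.subst (λ e → IsPrimitive e w) (ℕ.≤-antisym D≤d d≤D) w-primitive

open import Data.Nat using (_^_)

-- Rotations of the index set.

module _ (n : ℕ) where

  toℕ-mod : ∀ a → toℕ (a mod suc n) ≡ a % suc n
  toℕ-mod a = Fin.toℕ-fromℕ< (m%n<n a (suc n))

  mod-+ : ∀ a b → (toℕ (a mod suc n) ℕ.+ b) mod suc n ≡ (a ℕ.+ b) mod suc n
  mod-+ a b = Fin.toℕ-injective (begin
    toℕ ((toℕ (a mod suc n) ℕ.+ b) mod suc n)  ≡⟨ toℕ-mod (toℕ (a mod suc n) ℕ.+ b) ⟩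
    (toℕ (a mod suc n) ℕ.+ b) % suc n          ≡⟨ ≡.cong (λ k → (k ℕ.+ b) % suc n) (toℕ-mod a) ⟩
    (a % suc n ℕ.+ b) % suc n                  ≡⟨ %-distribˡ-+ (a % suc n) b (suc n) ⟩
    (a % suc n % suc n ℕ.+ b % suc n) % suc n  ≡⟨ ≡.cong (λ k → (k ℕ.+ b % suc n) % suc n) (m%n%n≡m%n a (suc n)) ⟩
    (a % suc n ℕ.+ b % suc n) % suc n          ≡⟨ %-distribˡ-+ a b (suc n) ⟨
    (a ℕ.+ b) % suc n                          ≡⟨ toℕ-mod (a ℕ.+ b) ⟨
    toℕ ((a ℕ.+ b) mod suc n)                  ∎)
    where open ≡.≡-Reasoning

  mod-multiple : ∀ (i : Fin (suc n)) r → (toℕ i ℕ.+ r ℕ.* suc n) mod suc n ≡ i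
  mod-multiple i r = Fin.toℕ-injective (≡.trans (toℕ-mod (toℕ i ℕ.+ r ℕ.* suc n))
    (≡.trans ([m+kn]%n≡m%n (toℕ i) r (suc n)) (m<n⇒m%n≡m (Fin.toℕ<n i))))

  rotate : ℕ → Fin (suc n) → Fin (suc n)
  rotate r i = (toℕ i ℕ.+ r) mod suc n

  rotate-inverse : ∀ a b r → a ℕ.+ b ≡ r ℕ.* suc n → ∀ i → rotate b (rotate a i) ≡ i
  rotate-inverse a b r eq i = ≡.trans (mod-+ (toℕ i ℕ.+ a) b)
    (≡.trans (≡.cong (_mod suc n) (≡.trans (ℕ.+-assoc (toℕ i) a b) (≡.cong (toℕ i ℕ.+_) eq))) (mod-multiple i r))

  r*n+r : ∀ r → r ℕ.* n ℕ.+ r ≡ r ℕ.* suc n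
  r*n+r r = ≡.trans (ℕ.+-comm (r ℕ.* n) r) (≡.sym (ℕ.*-suc r n))

  -- Rotation by `r * n` is the inverse, since r + r n is a multiple of n + 1.
  rotation : ℕ → Permutation (suc n) (suc n)
  rotation r = permutation (rotate r) (rotate (r ℕ.* n))
    (rotate-inverse (r ℕ.* n) r r (r*n+r r)) (rotate-inverse r (r ℕ.* n) r (≡.sym (ℕ.*-suc r n)))

-- Cyclic shifts of vectors and the counting bound.

module Covering (F : Field) (m : ℕ) (size : HasSize F (suc (suc m))) where
  open Field F hiding (zero)
  open FiniteField F m size
  open LinAlg F renaming (∑ to ∑ᵈ)
  open import Algebra.Properties.Semiring.Sum semiring
  open import Algebra.Properties.Ring ring using (-‿distribʳ-*; -0#≈0#; -‿+-comm)
  open import Algebra.Properties.Group +-group using (inverseˡ-unique)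
  open import Relation.Binary.Reasoning.Setoid setoid

  ∑ᵈ≈sum : ∀ {k} (f : Fin k → Carrier) → ∑ᵈ f ≈ sum f
  ∑ᵈ≈sum {zero}  f = refl
  ∑ᵈ≈sum {suc k} f = +-congˡ (∑ᵈ≈sum (f ∘ suc))

  lincomb-congˡ : ∀ {k n} {c c′ : Fin k → Carrier} (b : Fin k → Vec n) → (∀ i → c i ≈ c′ i) → lincomb c b ≈ᵥ lincomb c′ b
  lincomb-congˡ {k} {_} {c} {c′} b c≈c′ j = trans (∑ᵈ≈sum (λ i → c i * b i j))
    (trans (sum-cong k λ i → *-congʳ (c≈c′ i)) (sym (∑ᵈ≈sum (λ i → c′ i * b i j))))

  σ^-cong : ∀ {n} r {u v : Vec (suc n)} → u ≈ᵥ v → σ^ r u ≈ᵥ σ^ r v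
  σ^-cong zero    u≈v i = u≈v i
  σ^-cong (suc r) u≈v i = σ^-cong r u≈v _

  -- Each shift reads the entry at i + n, which is i - 1 modulo n + 1.
  σ^-rotate : ∀ {n} r (u : Vec (suc n)) i → σ^ r u i ≡ u (rotate n (r ℕ.* n) i)
  σ^-rotate {n} zero    u i = ≡.cong u (≡.sym (mod-multiple n i 0))
  σ^-rotate {n} (suc r) u i = ≡.trans (σ^-rotate r u (rotate n n i))
    (≡.cong u (≡.trans (mod-+ n (toℕ i ℕ.+ n) (r ℕ.* n)) (≡.cong (_mod suc n) (ℕ.+-assoc (toℕ i) n (r ℕ.* n)))))

  -- A vector is determined by a rotation and the coefficients of an element of `U`, so `locate`
  -- gives q^N ≤ N q^e for N = n + 1 and e the dimension of `U`. As N < q^(d+1), this rules out d +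
  -- 1 + e ≤ N.
  codim-bound : ∀ n d → suc (suc n) ≤ q ^ suc d → (U : Subspace (suc n)) → CyclicallyCovering U → codim U ≤ d
  codim-bound n d N<q^d U covering = ℕ.m≤n+o⇒m∸n≤o (suc n) e (ℕ.≤-pred (ℕ.≰⇒> λ d+e≤N →
    ℕ.<⇒≱ strict (ℕ.≤-trans (ℕ.^-monoʳ-≤ q (≡.subst (_≤ suc n) (≡.cong suc (ℕ.+-comm e d)) d+e≤N)) (Fin.injective⇒≤ locate-injective))))
    where
    open Subspace U renaming (dim to e)

    strict : suc n ℕ.* q ^ e < q ^ (suc d ℕ.+ e)
    strict = ≡.subst (suc n ℕ.* q ^ e <_) (≡.sym (ℕ.^-distribˡ-+-* q (suc d) e))
      (ℕ.*-monoˡ-< (q ^ e) {{ℕ.m^n≢0 q e}} N<q^d)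

    shift-of : Fin (q ^ suc n) → Fin (suc n)
    shift-of k = proj₁ (covering (decode k))

    coefficients : Fin (q ^ suc n) → Fin e → Carrier
    coefficients k = proj₁ (proj₁ (proj₂ (proj₂ (covering (decode k)))))

    recover : ∀ k → decode k ≈ᵥ σ^ (toℕ (shift-of k)) (lincomb (coefficients k) basis)
    recover k i with covering (decode k)
    ... | r , u , (c , u≈) , x≈ = trans (x≈ i) (σ^-cong (toℕ r) u≈ i)

    locate : Fin (q ^ suc n) → Fin (suc n ℕ.* q ^ e)
    locate k = combine (shift-of k) (code (coefficients k))

    locate-injective : ∀ {k l} → locate k ≡ locate l → k ≡ l
    locate-injective {k} {l} eq
      with Fin.combine-injective (shift-of k) (code (coefficients k)) (shift-of l) (code (coefficients l)) eq
    ... | r≡ , c≡ = decode-injective {suc n} λ i → begin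
      decode {suc n} k i  ≈⟨ recover k i ⟩
      σ^ (toℕ (shift-of k)) (lincomb (coefficients k) basis) i  ≈⟨ σ^-cong (toℕ (shift-of k)) (lincomb-congˡ basis (code-injective {e} {coefficients k} {coefficients l} c≡)) i ⟩
      σ^ (toℕ (shift-of k)) (lincomb (coefficients l) basis) i  ≡⟨ ≡.cong (λ r → σ^ (toℕ r) (lincomb (coefficients l) basis) i) r≡ ⟩
      σ^ (toℕ (shift-of l)) (lincomb (coefficients l) basis) i  ≈⟨ recover l i ⟨
      decode {suc n} l i  ∎

  -- A covering subspace of codimension d, for N = (d + 1) + l.

  module _ (d l : ℕ) (N+1≡q^d : suc (suc (d ℕ.+ l)) ≡ q ^ suc d) where
    open Sequences commRing
    open PrimitiveSequences F m size (d ℕ.+ l) (suc d) N+1≡q^d using (N; IsPrimitive; primitiveSequence; unshift)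
    open PeriodicSequences commRing N

    private
      w : Seq
      w = proj₁ primitiveSequence

      open IsPrimitive (proj₂ primitiveSequence)

    -- The remainder of X^(d+1+t) modulo the annihilator of w. The d + 1 low positions of a vector
    -- belong to the basis w, ..., Xᵈ w; the l high ones are to be reduced to it.
    reduced : Fin l → Fin (suc d) → Carrier
    reduced t = proj₁ (recurrent (suc d ℕ.+ toℕ t))

    kronecker : ∀ {k} → Fin k → Fin k → Carrier
    kronecker zero    zero    = 1#
    kronecker zero    (suc _) = 0#
    kronecker (suc _) zero    = 0#
    kronecker (suc i) (suc j) = kronecker i j

    sum-zero : ∀ k {f : Fin k → Carrier} → (∀ i → f i ≈ 0#) → sum f ≈ 0#
    sum-zero k f≈0 = trans (sum-cong k f≈0) (sum-replicate-zero k)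

    sum-kronecker : ∀ {k} (c : Fin k → Carrier) t → ∑[ i < k ] (c i * kronecker i t) ≈ c t
    sum-kronecker {suc k} c zero    = trans (+-cong (*-identityʳ _) (sum-zero k λ i → zeroʳ _)) (+-identityʳ _)
    sum-kronecker {suc k} c (suc t) = trans (+-cong (zeroʳ _) (sum-kronecker (c ∘ suc) t)) (+-identityˡ _)

    sum-splitAt : ∀ k {l} (f : Fin (k ℕ.+ l) → Carrier) → sum f ≈ ∑[ i < k ] f (i ↑ˡ l) + ∑[ j < l ] f (k ↑ʳ j)
    sum-splitAt zero    f = sym (+-identityˡ _)
    sum-splitAt (suc k) f = trans (+-congˡ (sum-splitAt k (f ∘ suc))) (sym (+-assoc _ _ _))

    -- The vectors e₀ and e_{d+1+t} - Σ_{0<j≤d} (reduced t j) e_j form a basis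
    -- of { x ∣ Σ xₖ Xᵏ w ∈ F w }.
    entry : Fin (suc l) → Fin (suc d) ⊎ Fin l → Carrier
    entry zero    (inj₁ zero)    = 1#
    entry zero    (inj₁ (suc j)) = 0#
    entry zero    (inj₂ t)       = 0#
    entry (suc i) (inj₁ zero)    = 0#
    entry (suc i) (inj₁ (suc j)) = - reduced i (suc j)
    entry (suc i) (inj₂ t)       = kronecker i t

    basis : Fin (suc l) → Vec N
    basis i k = entry i (splitAt (suc d) k)

    combined : (Fin (suc l) → Carrier) → Fin (suc d) ⊎ Fin l → Carrier
    combined c (inj₁ zero)    = c zero
    combined c (inj₁ (suc j)) = - ∑[ t < l ] (c (suc t) * reduced t (suc j))
    combined c (inj₂ t)       = c (suc t)

    sum-neg : ∀ k (f : Fin k → Carrier) → ∑[ i < k ] (- f i) ≈ - sum f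
    sum-neg zero    f = sym -0#≈0#
    sum-neg (suc k) f = trans (+-congˡ (sum-neg k (f ∘ suc))) (-‿+-comm _ _)

    sum-entry : ∀ c x → ∑[ i < suc l ] (c i * entry i x) ≈ combined c x
    sum-entry c (inj₁ zero)    = trans (+-cong (*-identityʳ _) (sum-zero l λ i → zeroʳ _)) (+-identityʳ _)
    sum-entry c (inj₁ (suc j)) = begin
      c zero * 0# + ∑[ t < l ] (c (suc t) * - reduced t (suc j))  ≈⟨ trans (+-congʳ (zeroʳ _)) (+-identityˡ _) ⟩
      ∑[ t < l ] (c (suc t) * - reduced t (suc j))    ≈⟨ sum-cong l (λ t → sym (-‿distribʳ-* _ _)) ⟩
      ∑[ t < l ] (- (c (suc t) * reduced t (suc j)))  ≈⟨ sum-neg l (λ t → c (suc t) * reduced t (suc j)) ⟩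
      - ∑[ t < l ] (c (suc t) * reduced t (suc j))    ∎
    sum-entry c (inj₂ t)       = trans (+-cong (zeroʳ _) (sum-kronecker (c ∘ suc) t)) (+-identityˡ _)

    lincomb-basis : ∀ c k → lincomb c basis k ≈ combined c (splitAt (suc d) k)
    lincomb-basis c k = trans (∑ᵈ≈sum (λ i → c i * basis i k)) (sum-entry c (splitAt (suc d) k))

    U : Subspace N
    U = record { dim = suc l ; basis = basis ; indep = indep }
      where
      indep : LinIndep basis
      -- The coefficients can be read off a combination, at position 0 and at the high positions.
      indep c c≈0 zero    = trans (sym (lincomb-basis c zero)) (c≈0 zero)
      indep c c≈0 (suc t) = trans (reflexive (≡.cong (combined c) (≡.sym (Fin.splitAt-↑ʳ (suc d) l t))))
        (trans (sym (lincomb-basis c (suc d ↑ʳ t))) (c≈0 (suc d ↑ʳ t)))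

    codim-U : codim U ≡ d
    codim-U = ℕ.m+n∸n≡m d l

    -- Reducing the high terms turns the hypothesis into an equation between combinations of w, ...,
    -- Xᵈ w. By independence, the entries of u at 0 < j ≤ d are forced by the high ones, exactly as
    -- in `combined`; the coefficient at 0 leaves `u zero` free, as `a` is arbitrary.
    line⇒∈U : ∀ u a → comb u w ≐ (λ i → a * w i) → u ∈ U
    line⇒∈U u a u-line = c , λ k → trans (u≈combined k) (sym (lincomb-basis c k))
      where
      c : Fin (suc l) → Carrier
      c zero    = u zero
      c (suc t) = u (suc d ↑ʳ t)

      low : Fin (suc d) → Carrier
      low j = u (j ↑ˡ l)

      high : Fin (suc d) → Carrier
      high j = ∑[ t < l ] (c (suc t) * reduced t j)

      first : Fin (suc d) → Carrier
      first zero    = a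
      first (suc _) = 0#

      comb-split : comb (λ j → low j + high j) w ≐ comb first w
      comb-split i = begin
        comb (λ j → low j + high j) w i          ≈⟨ comb-+ low high w i ⟩
        comb low w i + comb high w i             ≈⟨ +-congˡ (comb-sum (c ∘ suc) reduced w i) ⟩
        comb low w i + ∑[ t < l ] (c (suc t) * comb (reduced t) w i)
          ≈⟨ +-cong (sum-cong (suc d) λ j → reflexive (≡.cong (λ k → low j * w (k ℕ.+ i)) (≡.sym (Fin.toℕ-↑ˡ j l))))
               (sum-cong l λ t → *-congˡ (trans (sym (proj₂ (recurrent (suc d ℕ.+ toℕ t)) i))
                 (reflexive (≡.cong (λ k → w (k ℕ.+ i)) (≡.sym (Fin.toℕ-↑ʳ (suc d) t)))))) ⟩
        ∑[ j < suc d ] (u (j ↑ˡ l) * w (toℕ (j ↑ˡ l) ℕ.+ i)) + ∑[ t < l ] (u (suc d ↑ʳ t) * w (toℕ (suc d ↑ʳ t) ℕ.+ i))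
          ≈⟨ sum-splitAt (suc d) (λ k → u k * w (toℕ k ℕ.+ i)) ⟨
        comb u w i                               ≈⟨ u-line i ⟩
        a * w i                                  ≈⟨ +-identityʳ _ ⟨
        a * w i + 0#                             ≈⟨ +-congˡ (sum-zero d λ j → zeroˡ _) ⟨
        comb first w i                           ∎

      at : ∀ x → u (join (suc d) l x) ≈ combined c x
      at (inj₁ zero)    = refl
      at (inj₁ (suc j)) = inverseˡ-unique _ _ (comb-injective w independent (λ j → low j + high j) first comb-split (suc j))
      at (inj₂ t)       = refl

      u≈combined : ∀ k → u k ≈ combined c (splitAt (suc d) k)
      u≈combined k = trans (reflexive (≡.cong u (≡.sym (Fin.join-splitAt (suc d) l k)))) (at (splitAt (suc d) k))

    w-mod : ∀ a i → w (toℕ (a mod N) ℕ.+ i) ≈ w (a ℕ.+ i)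
    w-mod a i = begin
      w (toℕ (a mod N) ℕ.+ i)             ≡⟨ ≡.cong (λ k → w (k ℕ.+ i)) (toℕ-mod (d ℕ.+ l) a) ⟩
      w (a % N ℕ.+ i)                     ≈⟨ period-* period (a / N) _ ⟨
      w (a / N ℕ.* N ℕ.+ (a % N ℕ.+ i))     ≡⟨ ≡.cong w (move (a / N ℕ.* N) (a % N) i) ⟩
      w (a % N ℕ.+ a / N ℕ.* N ℕ.+ i)       ≡⟨ ≡.cong (λ k → w (k ℕ.+ i)) (m≡m%n+[m/n]*n a N) ⟨
      w (a ℕ.+ i)                         ∎
      where
      move : ∀ b c i → b ℕ.+ (c ℕ.+ i) ≡ c ℕ.+ b ℕ.+ i
      move = solve-∀

    -- Rotating the coefficients by r multiplies the polynomial by X^(-r) modulo Xᴺ - 1, and w has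
    -- period N. The sum is reindexed along the rotation.
    comb-rotate : ∀ (x : Vec N) r i → comb (x ∘ rotate (d ℕ.+ l) r) w (r ℕ.+ i) ≈ comb x w i
    comb-rotate x r i = begin
      ∑[ k < N ] (x (ρ k) * w (toℕ k ℕ.+ (r ℕ.+ i)))  ≈⟨ sum-cong N (λ k → *-congˡ {x (ρ k)} (trans
        (reflexive (≡.cong w (≡.sym (ℕ.+-assoc (toℕ k) r i)))) (sym (w-mod (toℕ k ℕ.+ r) i)))) ⟩
      ∑[ k < N ] (x (ρ k) * w (toℕ (ρ k) ℕ.+ i))    ≈⟨ sum-permute (λ k → x k * w (toℕ k ℕ.+ i)) (rotation (d ℕ.+ l) r) ⟨
      comb x w i                                  ∎
      where ρ = rotate (d ℕ.+ l) r

    comb-period : ∀ {k} (c : Fin k → Carrier) → HasPeriod N (comb c w)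
    comb-period c i = trans (sym (⟦combPoly⟧ c w (N ℕ.+ i)))
      (trans (⟦⟧-period (combPoly c) period i) (⟦combPoly⟧ c w i))

    on-orbit : ∀ (x : Vec N) → ∃ λ (r : Fin N) → ∃ λ a → comb x w ≐ λ i → a * w (toℕ r ℕ.+ i)
    on-orbit x = cases (proj₁ x∈span) (proj₂ x∈span) (transitive (proj₁ x∈span))
      where
      x∈span : Span (suc d) w (⟦ combPoly x ⟧ w)
      x∈span = span w (recurrent (suc d)) (combPoly x)

      cases : ∀ c → ⟦ combPoly x ⟧ w ≐ comb c w →
        comb c w ≐ (λ _ → 0#) ⊎ (∃ λ (r : Fin N) → comb c w ≐ λ i → w (toℕ r ℕ.+ i)) →
        ∃ λ (r : Fin N) → ∃ λ a → comb x w ≐ λ i → a * w (toℕ r ℕ.+ i)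
      -- The zero sequence is 0 times any shift of w; shift 0 is taken. Otherwise the scalar is 1.
      cases c x≐ (inj₁ ≐0)       = zero , 0# , λ i →
        trans (sym (⟦combPoly⟧ x w i)) (trans (x≐ i) (trans (≐0 i) (sym (zeroˡ _))))
      cases c x≐ (inj₂ (r , ≐w)) = r , 1# , λ i →
        trans (sym (⟦combPoly⟧ x w i)) (trans (x≐ i) (trans (≐w i) (sym (*-identityˡ _))))

    -- If x is sent to a Xʳ w, then its rotation u by r is sent to a w and so lies in U; applying σ
    -- r times to u gives back x.
    U-covering : CyclicallyCovering U
    U-covering x = r , u , line⇒∈U u a u-line , λ i → reflexive (≡.sym (≡.trans (σ^-rotate (toℕ r) u i)
      (≡.cong x (rotate-inverse (d ℕ.+ l) R (toℕ r) (toℕ r) (r*n+r (d ℕ.+ l) (toℕ r)) i))))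
      where
      r : Fin N
      r = proj₁ (on-orbit x)

      a : Carrier
      a = proj₁ (proj₂ (on-orbit x))

      u : Vec N
      u = x ∘ rotate (d ℕ.+ l) (toℕ r)

      R : ℕ
      R = toℕ r ℕ.* (d ℕ.+ l)

      u-line : comb u w ≐ λ i → a * w i
      u-line i = begin
        comb u w i                        ≈⟨ unshift (toℕ r) (comb-period u) i ⟨
        comb u w (toℕ r ℕ.+ (R ℕ.+ i))    ≈⟨ comb-rotate x (toℕ r) (R ℕ.+ i) ⟩
        comb x w (R ℕ.+ i)                ≈⟨ proj₂ (proj₂ (on-orbit x)) (R ℕ.+ i) ⟩
        a * w (toℕ r ℕ.+ (R ℕ.+ i))       ≈⟨ *-congˡ (unshift (toℕ r) period i) ⟩
        a * w i                           ∎

  -- Ensures d + 1 ≤ N for N = q^(d+1) - 1, so that N splits as (d + 1) + l.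
  1+d<q^d : ∀ d → suc (suc d) ≤ q ^ suc d
  1+d<q^d zero    = s≤s (s≤s z≤n)
  1+d<q^d (suc d) = ℕ.≤-trans (s≤s (1+d<q^d d)) (ℕ.^-monoʳ-< q (s≤s (s≤s z≤n)) (ℕ.n<1+n (suc d)))

  maxCoveringCodim : ∀ d → IsMaxCoveringCodim (q ^ suc d ∸ 1) d
  maxCoveringCodim d = ≡.subst (λ N → IsMaxCoveringCodim N d) (≡.cong (_∸ 1) N+1≡q^d)
    ((U d l N+1≡q^d , U-covering d l N+1≡q^d , codim-U d l N+1≡q^d) , codim-bound (d ℕ.+ l) d (ℕ.≤-reflexive N+1≡q^d))
    where
    l : ℕ
    l = q ^ suc d ∸ suc (suc d)
    N+1≡q^d : suc (suc (d ℕ.+ l)) ≡ q ^ suc d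
    N+1≡q^d = ℕ.m+[n∸m]≡n (1+d<q^d d)

-- The value of h_q(q^d - 1) and its logarithmic form.

open import Data.Nat using (_+_)

theorem3p1 : (F : Field) (q : ℕ) → HasSize F q → (d : ℕ) → 1 ≤ d →
    LinAlg.IsMaxCoveringCodim F (q ^ d ∸ 1) (d ∸ 1)
    × (q ^ (d ∸ 1) ≤ q ^ d ∸ 1 × q ^ d ∸ 1 < q ^ (d ∸ 1 + 1))
theorem3p1 F zero size d 1≤d with Inverse.to size (Field.0# F)
... | ()
theorem3p1 F (suc zero) size d 1≤d = ⊥-elim (Field.0≉1 F (begin
  0#          ≈⟨ strictlyInverseʳ 0# ⟨
  from (to 0#) ≡⟨ ≡.cong from (all-equal (to 0#) (to 1#)) ⟩
  from (to 1#) ≈⟨ strictlyInverseʳ 1# ⟩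
  1#          ∎))
  where
  open Field F using (0#; 1#; setoid)
  open Inverse size using (to; from; strictlyInverseʳ)
  open import Relation.Binary.Reasoning.Setoid setoid
  all-equal : ∀ (i j : Fin 1) → i ≡ j
  all-equal zero zero = ≡.refl
theorem3p1 F q@(suc (suc m)) size (suc d) _ =
  Covering.maxCoveringCodim F m size d ,
  -- With d now standing for the exponent minus one, the two inequalities say that the integer part
  -- of log_q (q^(d+1) - 1) is d.
  ℕ.≤-pred (≡.subst (q ^ d <_) (≡.sym 1+pred) (ℕ.^-monoʳ-< q (s≤s (s≤s z≤n)) (ℕ.n<1+n d))) ,
  ≡.subst₂ _≤_ (≡.sym 1+pred) (≡.cong (q ^_) (ℕ.+-comm 1 d)) ℕ.≤-refl
  where
  1+pred : suc (q ^ suc d ∸ 1) ≡ q ^ suc d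
  1+pred = ℕ.m+[n∸m]≡n (ℕ.m^n>0 q (suc d))
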